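{- For every $n\ge 2$, $$f(n,n-1)=\sum_{j=0}^{n-1}\binom{n-j}{j}(-1)^j\,(n-1-j)!,$$ i.e. the number of upper-diagonal CNMs of size $n$ whose second diagonal $m_{1,n-1},m_{2,n-2},\dots,m_{n-1,1}$ consists entirely of zeros is given by this sum.
   Context: A complete non-ambiguous matrix (CNM) of size $n$ is an $n\times n$ matrix $M=(m_{i,j})$ with entries in $\{0,1\}$ whose support $T=\{(i,j): m_{i,j}=1\}$ (whose elements are called vertices) satisfies: (1) $(1,1)\in T$; (2) for every $p=(i,j)\in T$ with $p\neq(1,1)$, exactly one of the following holds: there is $(i',j)\in T$ with $i'<i$, or there is $(i,j')\in T$ with $j'<j$; (3) every row and every column of $M$ contains at least one vertex; (4) define the parent of $p=(i,j)\neq(1,1)$ to be $(i',j)$ with $i'<i$ maximal if such a vertex exists, and otherwise $(i,j')$ with $j'<j$ maximal; then every vertex is the parent of either zero or exactly two vertices. A vertex with no children is a leaf. A CNM of size $n$ is upper-diagonal if its leaves are exactly the positions $(i,n+1-i)$, $1\le i\le n$. $f(n,n-1)$ is the number of upper-diagonal CNMs of size $n$ with $m_{i,n-i}=0$ for all $1\le i\le n-1$. Binomial coefficients $\binom{a}{b}$ with $b>a\ge 0$ are $0$. -}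

module Defs where

open import Data.Bool.Base using (Bool; true; false)
open import Data.Bool.Properties using () renaming (_≟_ to _≟ᵇ_)
open import Data.Fin.Base using (Fin; toℕ; _≤_; _<_)
open import Data.Fin.Properties using (any?; all?; _≤?_; _<?_) renaming (_≟_ to _≟ᶠ_)
open import Data.Integer.Base as ℤ using (ℤ; 0ℤ)
open import Data.List.Base as List using (List; []; _∷_; length; filter; cartesianProductWith; upTo)
open import Data.List.Membership.Propositional using (_∈_)
open import Data.List.Membership.Propositional.Properties using (∈-cartesianProductWith⁺; ∈-filter⁺; ∈-filter⁻)
open import Data.List.Relation.Unary.All using ([]; _∷_)
open import Data.List.Relation.Unary.Any using (here; there)
open import Data.List.Relation.Unary.AllPairs using ([]; _∷_)
open import Data.List.Relation.Unary.Unique.Propositional using (Unique)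
open import Data.List.Relation.Unary.Unique.Propositional.Properties using (cartesianProductWith⁺; filter⁺)
open import Data.Nat.Base using (ℕ; zero; suc; _+_)
open import Data.Nat.Properties using () renaming (_≟_ to _≟ⁿ_)
open import Data.Product.Base using (∃; _×_; _,_; proj₁; proj₂; uncurry)
open import Data.Product.Properties using (≡-dec)
open import Data.Sum.Base using (_⊎_)
open import Data.Vec.Base as Vec using (Vec; lookup)
open import Data.Vec.Properties using (∷-injective)
open import Function.Bundles using (_⇔_; mk⇔; Equivalence)
open import Relation.Binary.Definitions using (DecidableEquality)
open import Relation.Binary.PropositionalEquality using (_≡_; _≢_; refl)
open import Relation.Nullary.Decidable using (Dec; map′; ¬?; _×-dec_; _⊎-dec_; _→-dec_)
open import Relation.Nullary.Negation using (¬_)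
open import Relation.Unary using (Pred; Decidable)

-- 0/1 matrices: true is the entry 1, false the entry 0.
Matrix : ℕ → Set
Matrix n = Vec (Vec Bool n) n

Pos : ℕ → Set
Pos n = Fin n × Fin n

-- One-based row and column numbers.
row col : ∀ {n} → Pos n → ℕ
row p = suc (toℕ (proj₁ p))
col p = suc (toℕ (proj₂ p))

entry : ∀ {n} → Matrix n → Pos n → Bool
entry M (i , j) = lookup (lookup M i) j

Vertex : ∀ {n} → Matrix n → Pos n → Set
Vertex M p = entry M p ≡ true

Origin : ∀ {n} → Pos n → Set
Origin p = row p ≡ 1 × col p ≡ 1

-- Above M (i , j) i′: (i′ , j) is a vertex above (i , j).
-- Left M (i , j) j′: (i , j′) is a vertex to the left of (i , j).
Above Left : ∀ {n} → Matrix n → Pos n → Fin n → Set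
Above M (i , j) i′ = i′ < i × Vertex M (i′ , j)
Left  M (i , j) j′ = j′ < j × Vertex M (i , j′)

ExactlyOneOf : Set → Set → Set
ExactlyOneOf A B = (A × ¬ B) ⊎ (¬ A × B)

IsMax : ∀ {n} → (Fin n → Set) → Fin n → Set
IsMax P k = P k × (∀ l → P l → l ≤ k)

-- Parent M q p: the vertex p is not the origin and q is its parent.
Parent : ∀ {n} → Matrix n → Pos n → Pos n → Set
Parent M (i′ , j′) p@(i , j) =
  Vertex M p × ¬ Origin p ×
  ( (j′ ≡ j × IsMax (Above M p) i′)
  ⊎ (¬ ∃ (Above M p) × i′ ≡ i × IsMax (Left M p) j′))

NoChildren TwoChildren : ∀ {n} → Matrix n → Pos n → Set
NoChildren  M q = ∀ p → ¬ Parent M q p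
TwoChildren M q = ∃ λ p₁ → ∃ λ p₂ →
  p₁ ≢ p₂ × (∀ p → Parent M q p ⇔ (p ≡ p₁ ⊎ p ≡ p₂))

Leaf : ∀ {n} → Matrix n → Pos n → Set
Leaf M q = Vertex M q × NoChildren M q

record IsCNM {n : ℕ} (M : Matrix n) : Set where
  field
    origin   : ∃ λ p → Origin p × Vertex M p
    xorParent : ∀ p → Vertex M p → ¬ Origin p → ExactlyOneOf (∃ (Above M p)) (∃ (Left M p))
    rows     : ∀ i → ∃ λ j → Vertex M (i , j)
    columns  : ∀ j → ∃ λ i → Vertex M (i , j)
    complete : ∀ q → Vertex M q → NoChildren M q ⊎ TwoChildren M q

IsUpperDiagonal : ∀ {n} → Matrix n → Set
IsUpperDiagonal {n} M = ∀ p → Leaf M p ⇔ row p + col p ≡ suc n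

ZeroSecondDiagonal : ∀ {n} → Matrix n → Set
ZeroSecondDiagonal {n} M = ∀ p → row p + col p ≡ n → entry M p ≡ false

Counted : ∀ {n} → Matrix n → Set
Counted M = IsCNM M × IsUpperDiagonal M × ZeroSecondDiagonal M

module _ {n : ℕ} where

  _≟ᵖ_ : DecidableEquality (Pos n)
  _≟ᵖ_ = ≡-dec _≟ᶠ_ _≟ᶠ_

  all-pos? : {P : Pos n → Set} → Decidable P → Dec (∀ p → P p)
  all-pos? P? = map′ uncurry (λ f i j → f (i , j)) (all? λ i → all? λ j → P? (i , j))

  any-pos? : {P : Pos n → Set} → Decidable P → Dec (∃ P)
  any-pos? P? = map′ (λ (i , j , x) → (i , j) , x) (λ ((i , j) , x) → i , j , x)
                     (any? λ i → any? λ j → P? (i , j))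

  _⇔?_ : {A B : Set} → Dec A → Dec B → Dec (A ⇔ B)
  a? ⇔? b? = map′ (λ (f , g) → mk⇔ f g) (λ e → Equivalence.to e , Equivalence.from e)
                  ((a? →-dec b?) ×-dec (b? →-dec a?))

  exactlyOneOf? : {A B : Set} → Dec A → Dec B → Dec (ExactlyOneOf A B)
  exactlyOneOf? a? b? = (a? ×-dec ¬? b?) ⊎-dec (¬? a? ×-dec b?)

  isMax? : {P : Fin n → Set} → Decidable P → Decidable (IsMax P)
  isMax? P? k = P? k ×-dec all? λ l → P? l →-dec (l ≤? k)

  origin? : Decidable (Origin {n})
  origin? p = (row p ≟ⁿ 1) ×-dec (col p ≟ⁿ 1)

  module _ (M : Matrix n) where

    vertex? : Decidable (Vertex M)
    vertex? p = entry M p ≟ᵇ true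

    above? : ∀ p → Decidable (Above M p)
    above? (i , j) i′ = (i′ <? i) ×-dec vertex? (i′ , j)

    left? : ∀ p → Decidable (Left M p)
    left? (i , j) j′ = (j′ <? j) ×-dec vertex? (i , j′)

    parent? : ∀ q p → Dec (Parent M q p)
    parent? (i′ , j′) p@(i , j) =
      vertex? p ×-dec ¬? (origin? p) ×-dec
      ( ((j′ ≟ᶠ j) ×-dec isMax? (above? p) i′)
      ⊎-dec (¬? (any? (above? p)) ×-dec (i′ ≟ᶠ i) ×-dec isMax? (left? p) j′))

    noChildren? : Decidable (NoChildren M)
    noChildren? q = all-pos? λ p → ¬? (parent? q p)

    twoChildren? : Decidable (TwoChildren M)
    twoChildren? q = any-pos? λ p₁ → any-pos? λ p₂ →
      ¬? (p₁ ≟ᵖ p₂) ×-dec all-pos? λ p → parent? q p ⇔? ((p ≟ᵖ p₁) ⊎-dec (p ≟ᵖ p₂))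

    isCNM? : Dec (IsCNM M)
    isCNM? = map′
      (λ (a , b , c , d , e) → record { origin = a ; xorParent = b ; rows = c ; columns = d ; complete = e })
      (λ c → let open IsCNM c in origin , xorParent , rows , columns , complete)
      (      any-pos? (λ p → origin? p ×-dec vertex? p)
       ×-dec all-pos? (λ p → vertex? p →-dec (¬? (origin? p) →-dec
                               exactlyOneOf? (any? (above? p)) (any? (left? p))))
       ×-dec all? (λ i → any? λ j → vertex? (i , j))
       ×-dec all? (λ j → any? λ i → vertex? (i , j))
       ×-dec all-pos? (λ q → vertex? q →-dec (noChildren? q ⊎-dec twoChildren? q)))

    isUpperDiagonal? : Dec (IsUpperDiagonal M)
    isUpperDiagonal? = all-pos? λ p →
      (vertex? p ×-dec noChildren? p) ⇔? (row p + col p ≟ⁿ suc n)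

    zeroSecondDiagonal? : Dec (ZeroSecondDiagonal M)
    zeroSecondDiagonal? = all-pos? λ p → (row p + col p ≟ⁿ n) →-dec (entry M p ≟ᵇ false)

  counted? : Decidable (Counted {n})
  counted? M = isCNM? M ×-dec isUpperDiagonal? M ×-dec zeroSecondDiagonal? M

vectors : {A : Set} → List A → ∀ n → List (Vec A n)
vectors xs zero    = Vec.[] ∷ []
vectors xs (suc n) = cartesianProductWith Vec._∷_ xs (vectors xs n)

matrices : ∀ n → List (Matrix n)
matrices n = vectors (vectors (false ∷ true ∷ []) n) n

counted : ∀ n → List (Matrix n)
counted n = filter counted? (matrices n)

-- The number f(n, n − 1).
f : ℕ → ℕ
f n = length (counted n)

∈-vectors : {A : Set} {xs : List A} → (∀ x → x ∈ xs) → ∀ {n} (v : Vec A n) → v ∈ vectors xs n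
∈-vectors all∈ Vec.[]       = here refl
∈-vectors all∈ (x Vec.∷ v) = ∈-cartesianProductWith⁺ Vec._∷_ (all∈ x) (∈-vectors all∈ v)

vectors-unique : {A : Set} {xs : List A} → Unique xs → ∀ n → Unique (vectors xs n)
vectors-unique u zero    = [] ∷ []
vectors-unique u (suc n) = cartesianProductWith⁺ Vec._∷_ ∷-injective u (vectors-unique u n)

∈-matrices : ∀ {n} (M : Matrix n) → M ∈ matrices n
∈-matrices = ∈-vectors (∈-vectors λ { false → here refl ; true → there (here refl) })

-- The next two facts say that f n is the cardinality of { M | Counted M }.
∈-counted : ∀ {n} (M : Matrix n) → M ∈ counted n ⇔ Counted M
∈-counted {n} M = mk⇔ (λ m → proj₂ (∈-filter⁻ counted? {v = M} {xs = matrices n} m))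
                      (∈-filter⁺ counted? {x = M} {xs = matrices n} (∈-matrices M))

counted-unique : ∀ n → Unique (counted n)
counted-unique n = filter⁺ counted? {xs = matrices n}
  (vectors-unique (vectors-unique (((λ ()) ∷ []) ∷ [] ∷ []) n) n)

-- Σ< n t = t 0 + … + t (n − 1)
Σ< : ℕ → (ℕ → ℤ) → ℤ
Σ< n t = List.foldr ℤ._+_ 0ℤ (List.map t (upTo n))

{-# OPTIONS --safe #-}
module Submission where

-- An upper-diagonal CNM is the same as a support on or above the antidiagonal,
-- containing it, in which the leftmost vertex of each row is the only one of that
-- row whose column already has a vertex higher up (such a column is open). Build it
-- from the top row down, keeping only the set O of open columns; each row also drops
-- the rightmost column. Without the condition on the second diagonal, the number
-- of completions from O is the product of c - 1 over the closed columns c. With it,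
-- a vertex at (i , n - i) allows deleting row i + 1 and column n + 1 - i, two such
-- vertices are never in adjacent rows, and inclusion-exclusion gives the signed sum
-- over nonadjacent sets S of closed columns of the same product for the columns
-- outside S. This sum satisfies the recursion of the row-by-row count, and from the
-- initial state it is the sum over j of (-1)^j C(n - j, j) (n - 1 - j)!.

open import Defs
open import Data.Nat.Base using (ℕ; _∸_; _≤_; _!)
open import Data.Nat.Combinatorics using (_C_)
open import Data.Integer.Base using (+_; -1ℤ; _*_; _^_)
open import Relation.Binary.PropositionalEquality using (_≡_)

open import Data.Bool.Base using (Bool; true; false; _∧_; _∨_; _xor_; not; if_then_else_)
open import Data.Bool.Properties using (if-∧; ∨-identityʳ; ∧-conicalˡ; ∧-conicalʳ; not-¬; ¬-not)
  renaming (_≟_ to _≟ᵇ_)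
open import Data.Fin.Base as Fin using (Fin; zero; suc; toℕ; fromℕ; inject₁; opposite)
import Data.Fin.Properties as Finₚ
open import Data.Integer.Base using (ℤ; 0ℤ; 1ℤ; _+_; _-_; -_)
import Data.Integer.Properties as ℤₚ
open import Data.Integer.Tactic.RingSolver using (solve-∀)
open import Data.List.Base as List using (List; []; _∷_; _++_; cartesianProductWith; filter; length)
open import Data.List.Properties using (map-applyUpTo; map-upTo)
open import Data.Nat.Base as ℕ using (zero; suc; _<_; z≤n; s≤s)
import Data.Nat.Properties as ℕₚ
open import Data.Nat.Combinatorics using (nCk+nC[k+1]≡[n+1]C[k+1]; k>n⇒nCk≡0)
open import Data.Product.Base using (∃; _×_; _,_; proj₁; proj₂)
open import Data.Sum.Base as Sum using (_⊎_; inj₁; inj₂; [_,_]′)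
open import Data.Vec.Base using (Vec; []; _∷_; _∷ʳ_; replicate; zipWith; map; tail; reverse; lookup)
open import Data.Vec.Properties using (reverse-∷; lookup-map; lookup-zipWith; lookup-replicate)
open import Function.Base using (_∘_; id)
open import Function.Bundles using (_⇔_; mk⇔; Equivalence)
open import Function.Construct.Composition using (_⇔-∘_)
open import Function.Construct.Symmetry using (⇔-sym)
open import Level using (0ℓ)
open import Relation.Binary.Definitions using (tri<; tri≈; tri>)
open import Relation.Binary.PropositionalEquality
  using (refl; sym; trans; cong; cong₂; subst; subst₂; module ≡-Reasoning)
open import Relation.Nullary.Decidable using (yes; no; does; does-⇔; _×-dec_)
open import Relation.Nullary.Negation using (¬_; contradiction)
open import Relation.Unary using (Pred; Decidable)

open ≡-Reasoning
open Equivalence using (to; from)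

-- Signed sums over nonadjacent sets of columns

Σ<-suc : ∀ n (t : ℕ → ℤ) → Σ< (suc n) t ≡ t 0 + Σ< n (t ∘ suc)
Σ<-suc n t = cong (λ l → t 0 + List.foldr _+_ 0ℤ l) (trans (map-applyUpTo suc t n) (sym (map-upTo (t ∘ suc) n)))

Σ<-cong : ∀ n {t u : ℕ → ℤ} → (∀ k → k < n → t k ≡ u k) → Σ< n t ≡ Σ< n u
Σ<-cong zero eq = refl
Σ<-cong (suc n) {t} {u} eq = begin
  Σ< (suc n) t           ≡⟨ Σ<-suc n t ⟩
  t 0 + Σ< n (t ∘ suc)   ≡⟨ cong₂ _+_ (eq 0 (s≤s z≤n)) (Σ<-cong n (λ k k<n → eq (suc k) (s≤s k<n))) ⟩
  u 0 + Σ< n (u ∘ suc)   ≡⟨ Σ<-suc n u ⟨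
  Σ< (suc n) u           ∎

Σ<-- : ∀ n (t u : ℕ → ℤ) → Σ< n (λ k → t k - u k) ≡ Σ< n t - Σ< n u
Σ<-- zero t u = refl
Σ<-- (suc n) t u = begin
  Σ< (suc n) (λ k → t k - u k)
    ≡⟨ Σ<-suc n (λ k → t k - u k) ⟩
  (t 0 - u 0) + Σ< n (λ k → t (suc k) - u (suc k))
    ≡⟨ cong (λ x → (t 0 - u 0) + x) (Σ<-- n (t ∘ suc) (u ∘ suc)) ⟩
  (t 0 - u 0) + (Σ< n (t ∘ suc) - Σ< n (u ∘ suc))
    ≡⟨ regroup (t 0) (u 0) (Σ< n (t ∘ suc)) (Σ< n (u ∘ suc)) ⟩
  (t 0 + Σ< n (t ∘ suc)) - (u 0 + Σ< n (u ∘ suc))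
    ≡⟨ cong₂ _-_ (Σ<-suc n t) (Σ<-suc n u) ⟨
  Σ< (suc n) t - Σ< (suc n) u ∎
  where
  regroup : ∀ a b c d → (a - b) + (c - d) ≡ (a + c) - (b + d)
  regroup = solve-∀

Σ<-last : ∀ n (t : ℕ → ℤ) → Σ< (suc n) t ≡ Σ< n t + t n
Σ<-last zero t = ℤₚ.+-comm (t 0) 0ℤ
Σ<-last (suc n) t = begin
  Σ< (suc (suc n)) t                  ≡⟨ Σ<-suc (suc n) t ⟩
  t 0 + Σ< (suc n) (t ∘ suc)          ≡⟨ cong (λ x → t 0 + x) (Σ<-last n (t ∘ suc)) ⟩
  t 0 + (Σ< n (t ∘ suc) + t (suc n))  ≡⟨ ℤₚ.+-assoc (t 0) _ _ ⟨
  t 0 + Σ< n (t ∘ suc) + t (suc n)    ≡⟨ cong (_+ t (suc n)) (Σ<-suc n t) ⟨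
  Σ< (suc n) t + t (suc n)            ∎

-- Multiplication by the variable on coefficient sequences: putting one more column into S raises
-- the degree `k` by one.
shift : (ℕ → ℤ) → ℕ → ℤ
shift t zero    = 0ℤ
shift t (suc k) = t k

Σ<-shift : ∀ n (t : ℕ → ℤ) → t n ≡ 0ℤ → Σ< (suc n) (shift t) ≡ Σ< (suc n) t
Σ<-shift n t tn≡0 = begin
  Σ< (suc n) (shift t)  ≡⟨ Σ<-suc n (shift t) ⟩
  0ℤ + Σ< n t           ≡⟨ ℤₚ.+-comm 0ℤ (Σ< n t) ⟩
  Σ< n t + 0ℤ           ≡⟨ cong (λ x → Σ< n t + x) tn≡0 ⟨
  Σ< n t + t n          ≡⟨ Σ<-last n t ⟨
  Σ< (suc n) t          ∎

-- The head of a state vector is the rightmost column. With S ranging over the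
-- sets of k pairwise nonadjacent closed columns other than the leftmost one,
-- weight O k is (-1)^k times the sum over S of the product, over the closed
-- columns c ∉ S, of the number of columns left of c outside S. In weight∌ the
-- rightmost column is not in S.
weight weight∌ : ∀ {m} → Vec Bool m → ℕ → ℤ
weight []          zero    = 1ℤ
weight []          (suc k) = 0ℤ
weight (true  ∷ O) k       = weight O k
weight (false ∷ O) k       = weight∌ (false ∷ O) k - shift (weight∌ O) k
weight∌ []                  k = 0ℤ
weight∌ (true  ∷ O)         k = weight O k
weight∌ {suc m} (false ∷ O) k = (+ m - + k) * weight O k

-- The sum of φ (O ∪ r) over the admissible rows r with at least one vertex: the
-- leftmost vertex of r is its only one in O (see Σ∈-rowMeeting).
ΣrowMeeting : ∀ {m} → Vec Bool m → (Vec Bool m → ℤ) → ℤ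
ΣrowMeeting []          φ = 0ℤ
ΣrowMeeting (true  ∷ O) φ = ΣrowMeeting O (φ ∘ (true ∷_)) + φ (true ∷ O)
ΣrowMeeting (false ∷ O) φ = ΣrowMeeting O (φ ∘ (false ∷_)) + ΣrowMeeting O (φ ∘ (true ∷_))

ΣrowMeeting-cong : ∀ {m} (O : Vec Bool m) {φ ψ} → (∀ P → φ P ≡ ψ P) → ΣrowMeeting O φ ≡ ΣrowMeeting O ψ
ΣrowMeeting-cong []          eq = refl
ΣrowMeeting-cong (true  ∷ O) eq = cong₂ _+_ (ΣrowMeeting-cong O (eq ∘ (true ∷_))) (eq _)
ΣrowMeeting-cong (false ∷ O) eq = cong₂ _+_ (ΣrowMeeting-cong O (eq ∘ (false ∷_))) (ΣrowMeeting-cong O (eq ∘ (true ∷_)))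

ΣrowMeeting-linear : ∀ {m} (O : Vec Bool m) (a b : ℤ) φ ψ →
  ΣrowMeeting O (λ P → a * φ P + b * ψ P) ≡ a * ΣrowMeeting O φ + b * ΣrowMeeting O ψ
ΣrowMeeting-linear []          a b φ ψ = vanish a b
  where
  vanish : ∀ a b → 0ℤ ≡ a * 0ℤ + b * 0ℤ
  vanish = solve-∀
ΣrowMeeting-linear (true  ∷ O) a b φ ψ =
  trans (cong (_+ (a * φ (true ∷ O) + b * ψ (true ∷ O))) (ΣrowMeeting-linear O a b (φ ∘ (true ∷_)) (ψ ∘ (true ∷_))))
        (regroup a b _ _ _ _)
  where
  regroup : ∀ a b x y z w → (a * x + b * y) + (a * z + b * w) ≡ a * (x + z) + b * (y + w)
  regroup = solve-∀
ΣrowMeeting-linear (false ∷ O) a b φ ψ =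
  trans (cong₂ _+_ (ΣrowMeeting-linear O a b (φ ∘ (false ∷_)) (ψ ∘ (false ∷_)))
                   (ΣrowMeeting-linear O a b (φ ∘ (true ∷_)) (ψ ∘ (true ∷_))))
        (regroup a b _ _ _ _)
  where
  regroup : ∀ a b x y z w → (a * x + b * y) + (a * z + b * w) ≡ a * (x + z) + b * (y + w)
  regroup = solve-∀

ΣrowMeeting-Σ< : ∀ {m} (O : Vec Bool m) n (φ : ℕ → Vec Bool m → ℤ) →
  ΣrowMeeting O (λ P → Σ< n (λ k → φ k P)) ≡ Σ< n (λ k → ΣrowMeeting O (φ k))
ΣrowMeeting-Σ< O zero φ = ΣrowMeeting-linear O 0ℤ 0ℤ (λ _ → 0ℤ) (λ _ → 0ℤ)
ΣrowMeeting-Σ< O (suc n) φ = begin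
  ΣrowMeeting O (λ P → Σ< (suc n) (λ k → φ k P))
    ≡⟨ ΣrowMeeting-cong O (λ P → trans (Σ<-suc n (λ k → φ k P)) (units (φ 0 P) (Σ< n (λ k → φ (suc k) P)))) ⟩
  ΣrowMeeting O (λ P → 1ℤ * φ 0 P + 1ℤ * Σ< n (λ k → φ (suc k) P))
    ≡⟨ ΣrowMeeting-linear O 1ℤ 1ℤ (φ 0) _ ⟩
  1ℤ * ΣrowMeeting O (φ 0) + 1ℤ * ΣrowMeeting O (λ P → Σ< n (λ k → φ (suc k) P))
    ≡⟨ units (ΣrowMeeting O (φ 0)) (ΣrowMeeting O (λ P → Σ< n (λ k → φ (suc k) P))) ⟨
  ΣrowMeeting O (φ 0) + ΣrowMeeting O (λ P → Σ< n (λ k → φ (suc k) P))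
    ≡⟨ cong (λ x → ΣrowMeeting O (φ 0) + x) (ΣrowMeeting-Σ< O n (φ ∘ suc)) ⟩
  ΣrowMeeting O (φ 0) + Σ< n (λ k → ΣrowMeeting O (φ (suc k)))
    ≡⟨ Σ<-suc n (λ k → ΣrowMeeting O (φ k)) ⟨
  Σ< (suc n) (λ k → ΣrowMeeting O (φ k)) ∎
  where
  units : ∀ a b → a + b ≡ 1ℤ * a + 1ℤ * b
  units = solve-∀

-- Rows act diagonally: in degree `k`, `weight` and `weight∌` are eigenvectors of `ΣrowMeeting` for
-- the eigenvalue `m - k`, the number of columns outside S. The four statements form one induction
-- over the columns, since the closed case of `weight` refers to `weight∌` and conversely.
ΣrowMeeting-weight : ∀ {m} (O : Vec Bool m) k →
  ΣrowMeeting O (λ P → weight P k) ≡ (+ m - + k) * weight O k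
ΣrowMeeting-weight∌ : ∀ {m} (O : Vec Bool m) k →
  ΣrowMeeting O (λ P → weight∌ P k) ≡ (+ m - + k) * weight∌ O k
ΣrowMeeting-shift : ∀ {m} (O : Vec Bool m) k →
  ΣrowMeeting O (λ P → shift (weight∌ P) k) ≡ (+ suc m - + k) * shift (weight∌ O) k
-- The column in front stays closed and takes no part in the rows. Outside S it supplies a factor
-- `m - k` of its own besides the eigenvalue; inside S it leaves degree `k - 1` to the other
-- columns.
ΣrowMeeting-weight-false : ∀ {m} (O : Vec Bool m) k →
  ΣrowMeeting O (λ P → weight (false ∷ P) k) ≡
  (+ m - + k) * ((+ m - + k) * weight O k) - (+ suc m - + k) * shift (weight∌ O) k

ΣrowMeeting-weight []          zero    = refl
ΣrowMeeting-weight []          (suc k) = sym (ℤₚ.*-zeroʳ (0ℤ - + suc k))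
ΣrowMeeting-weight {suc m} (true  ∷ O) k =
  trans (cong (_+ weight O k) (ΣrowMeeting-weight O k)) (regroup (+ m) (+ k) (weight O k))
  where
  regroup : ∀ m k w → (m - k) * w + w ≡ (1ℤ + m - k) * w
  regroup = solve-∀
ΣrowMeeting-weight {suc m} (false ∷ O) k =
  trans (cong₂ _+_ (ΣrowMeeting-weight-false O k) (ΣrowMeeting-weight O k))
        (regroup (+ m) (+ k) (weight O k) _)
  where
  regroup : ∀ m k w s → (m - k) * ((m - k) * w) - (1ℤ + m - k) * s + (m - k) * w ≡
                        (1ℤ + m - k) * ((m - k) * w - s)
  regroup = solve-∀

ΣrowMeeting-weight∌ []          k = sym (ℤₚ.*-zeroʳ (0ℤ - + k))
ΣrowMeeting-weight∌ {suc m} (true  ∷ O) k = ΣrowMeeting-weight (true ∷ O) k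
ΣrowMeeting-weight∌ {suc m} (false ∷ O) k = begin
  ΣrowMeeting O (λ P → (+ m - + k) * weight P k) + ΣrowMeeting O (λ P → weight P k)
    ≡⟨ cong (_+ w) (ΣrowMeeting-cong O (λ P → pad (+ m - + k) (weight P k))) ⟩
  ΣrowMeeting O (λ P → (+ m - + k) * weight P k + 0ℤ * weight P k) + ΣrowMeeting O (λ P → weight P k)
    ≡⟨ cong (_+ w) (ΣrowMeeting-linear O (+ m - + k) 0ℤ (λ P → weight P k) (λ P → weight P k)) ⟩
  ((+ m - + k) * w + 0ℤ * w) + w
    ≡⟨ cong (λ w → ((+ m - + k) * w + 0ℤ * w) + w) (ΣrowMeeting-weight O k) ⟩
  ((+ m - + k) * ((+ m - + k) * weight O k) + 0ℤ * ((+ m - + k) * weight O k)) + (+ m - + k) * weight O k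
    ≡⟨ regroup (+ m) (+ k) (weight O k) ⟩
  (+ suc m - + k) * ((+ m - + k) * weight O k) ∎
  where
  w : ℤ
  w = ΣrowMeeting O (λ P → weight P k)
  pad : ∀ a b → a * b ≡ a * b + 0ℤ * b
  pad = solve-∀
  regroup : ∀ m k w → ((m - k) * ((m - k) * w) + 0ℤ * ((m - k) * w)) + (m - k) * w ≡
                      (1ℤ + m - k) * ((m - k) * w)
  regroup = solve-∀

ΣrowMeeting-shift {m} O zero =
  trans (ΣrowMeeting-linear O 0ℤ 0ℤ (λ _ → 0ℤ) (λ _ → 0ℤ)) (sym (ℤₚ.*-zeroʳ (+ suc m - 0ℤ)))
ΣrowMeeting-shift {m} O (suc k) =
  trans (ΣrowMeeting-weight∌ O k) (regroup (+ m) (+ k) (weight∌ O k))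
  where
  regroup : ∀ m k w → (m - k) * w ≡ (1ℤ + m - (1ℤ + k)) * w
  regroup = solve-∀

ΣrowMeeting-weight-false {m} O k = begin
  ΣrowMeeting O (λ P → (+ m - + k) * weight P k - shift (weight∌ P) k)
    ≡⟨ ΣrowMeeting-cong O (λ P → cong (λ x → (+ m - + k) * weight P k + x) (negate (shift (weight∌ P) k))) ⟩
  ΣrowMeeting O (λ P → (+ m - + k) * weight P k + -1ℤ * shift (weight∌ P) k)
    ≡⟨ ΣrowMeeting-linear O (+ m - + k) -1ℤ _ _ ⟩
  (+ m - + k) * ΣrowMeeting O (λ P → weight P k) + -1ℤ * ΣrowMeeting O (λ P → shift (weight∌ P) k)
    ≡⟨ cong₂ (λ x y → (+ m - + k) * x + y) (ΣrowMeeting-weight O k)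
             (trans (sym (negate _)) (cong -_ (ΣrowMeeting-shift O k))) ⟩
  (+ m - + k) * ((+ m - + k) * weight O k) - (+ suc m - + k) * shift (weight∌ O) k ∎
  where
  negate : ∀ x → - x ≡ -1ℤ * x
  negate = solve-∀

-- Fewer than `k` columns contain no S of size `k`. In `weight∌` one column is barred from S, or the
-- value is 0 by definition, so `m ≤ k` suffices.
weight-vanishes : ∀ {m} (O : Vec Bool m) {k} → m < k → weight O k ≡ 0ℤ
weight∌-vanishes : ∀ {m} (O : Vec Bool m) {k} → m ≤ k → weight∌ O k ≡ 0ℤ
weight-vanishes []          (s≤s _)   = refl
weight-vanishes (true  ∷ O) m<k       = weight-vanishes O (ℕₚ.<-trans (ℕₚ.n<1+n _) m<k)
weight-vanishes (false ∷ O) (s≤s m<k) =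
  cong₂ _-_ (weight∌-vanishes (false ∷ O) (ℕₚ.m≤n⇒m≤1+n m<k)) (weight∌-vanishes O (ℕₚ.<⇒≤ m<k))
weight∌-vanishes []          _   = refl
weight∌-vanishes (true  ∷ O) m<k = weight-vanishes O m<k
weight∌-vanishes {suc m} (false ∷ O) {k} m<k =
  trans (cong ((+ m - + k) *_) (weight-vanishes O m<k)) (ℤₚ.*-zeroʳ (+ m - + k))

-- The term with shift is the sum over the sets S containing the rightmost column;
-- it cancels exactly the rows with a vertex on the second diagonal.
ΣrowMeeting-Σweight : ∀ {m} n o (O : Vec Bool m) → suc m < n →
  ΣrowMeeting O (λ P → Σ< (suc n) (weight (o ∷ P))) ≡ Σ< (suc n) (weight (false ∷ o ∷ O))
ΣrowMeeting-Σweight {m} n true O m<n = begin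
  ΣrowMeeting O (λ P → Σ< (suc n) (weight P))
    ≡⟨ ΣrowMeeting-Σ< O (suc n) (λ k P → weight P k) ⟩
  Σ< (suc n) (λ k → ΣrowMeeting O (λ P → weight P k))
    -- The eigenvalue `m - k` is written as `(m + 1 - k) - 1`, because `m + 1 - k` is the factor of
    -- the closed column that the right-hand side has in front.
    ≡⟨ Σ<-cong (suc n) (λ k _ → trans (ΣrowMeeting-weight O k) (regroup (+ m) (+ k) (weight O k))) ⟩
  Σ< (suc n) (λ k → (+ suc m - + k) * weight O k - weight O k)
    ≡⟨ Σ<-- (suc n) (λ k → (+ suc m - + k) * weight O k) (weight O) ⟩
  Σ< (suc n) (λ k → (+ suc m - + k) * weight O k) - Σ< (suc n) (weight O)
    -- The subtracted sum is reindexed by one; the top term thereby lost has degree above the number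
    -- of columns and is 0.
    ≡⟨ cong (λ x → Σ< (suc n) (λ k → (+ suc m - + k) * weight O k) - x)
            (Σ<-shift n (weight O) (weight-vanishes O (ℕₚ.<-trans (ℕₚ.n<1+n m) m<n))) ⟨
  Σ< (suc n) (λ k → (+ suc m - + k) * weight O k) - Σ< (suc n) (shift (weight O))
    ≡⟨ Σ<-- (suc n) (λ k → (+ suc m - + k) * weight O k) (shift (weight O)) ⟨
  Σ< (suc n) (λ k → (+ suc m - + k) * weight O k - shift (weight O) k)
    ≡⟨ Σ<-cong (suc n) {λ k → (+ suc m - + k) * weight O k - shift (weight O) k}
                         {weight (false ∷ true ∷ O)} (λ { zero _ → refl ; (suc k) _ → refl }) ⟩
  Σ< (suc n) (weight (false ∷ true ∷ O)) ∎
  where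
  regroup : ∀ m k w → (m - k) * w ≡ (1ℤ + m - k) * w - w
  regroup = solve-∀
ΣrowMeeting-Σweight {m} n false O m<n = begin
  ΣrowMeeting O (λ P → Σ< (suc n) (weight (false ∷ P)))
    ≡⟨ ΣrowMeeting-Σ< O (suc n) (λ k P → weight (false ∷ P) k) ⟩
  Σ< (suc n) (λ k → ΣrowMeeting O (λ P → weight (false ∷ P) k))
    ≡⟨ Σ<-cong (suc n) (λ k _ → trans (ΣrowMeeting-weight-false O k)
                                      (regroup (+ m) (+ k) (weight O k) (shift (weight∌ O) k))) ⟩
  Σ< (suc n) (λ k → main k - weight∌ (false ∷ O) k)
    ≡⟨ Σ<-- (suc n) main (weight∌ (false ∷ O)) ⟩
  Σ< (suc n) main - Σ< (suc n) (weight∌ (false ∷ O))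
    ≡⟨ cong (λ x → Σ< (suc n) main - x)
            (Σ<-shift n (weight∌ (false ∷ O)) (weight∌-vanishes (false ∷ O) (ℕₚ.<⇒≤ m<n))) ⟨
  Σ< (suc n) main - Σ< (suc n) (shift (weight∌ (false ∷ O)))
    ≡⟨ Σ<-- (suc n) main (shift (weight∌ (false ∷ O))) ⟨
  Σ< (suc n) (weight (false ∷ false ∷ O)) ∎
  where
  main : ℕ → ℤ
  main = weight∌ (false ∷ false ∷ O)
  regroup : ∀ m k w s → (m - k) * ((m - k) * w) - (1ℤ + m - k) * s ≡
                        (1ℤ + m - k) * ((m - k) * w - s) - (m - k) * w
  regroup = solve-∀

-- Only column 1 counts as open before the first row: this makes the origin obey
-- the same rule as every other vertex, and forces it to be a vertex.
initial : ∀ m → Vec Bool (suc m)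
initial m = replicate m false ∷ʳ true


-- Closed form of the weights of the initial state

absorb-factorial : ∀ m k →
  (+ suc m - + k) * (+ ((suc m ∸ k) C k) * (-1ℤ ^ k) * + ((m ∸ k) !)) ≡
  + ((suc m ∸ k) C k) * (-1ℤ ^ k) * + ((suc m ∸ k) !)
absorb-factorial m k with k ℕₚ.≤? m
-- Truncated subtraction no longer agrees with the integer factor here, but the binomial coefficient
-- is 0.
... | no k≰m = begin
    (+ suc m - + k) * (+ c * s * + ((m ∸ k) !)) ≡⟨ cong (λ c → (+ suc m - + k) * (+ c * s * + ((m ∸ k) !))) c≡0 ⟩
    (+ suc m - + k) * 0ℤ                        ≡⟨ ℤₚ.*-zeroʳ (+ suc m - + k) ⟩
    0ℤ                                          ≡⟨ cong (λ c → + c * s * + ((suc m ∸ k) !)) c≡0 ⟨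
    + c * s * + ((suc m ∸ k) !)                 ∎
  where
  s = -1ℤ ^ k
  c = (suc m ∸ k) C k
  c≡0 : c ≡ 0
  c≡0 = k>n⇒nCk≡0 (subst (ℕ._< k) (sym (ℕₚ.m≤n⇒m∸n≡0 (ℕₚ.≰⇒> k≰m))) (ℕₚ.≤-<-trans z≤n (ℕₚ.≰⇒> k≰m)))
... | yes k≤m rewrite ℕₚ.+-∸-assoc 1 k≤m = begin
    (+ suc m - + k) * (+ c * s * + (d !))  ≡⟨ cong (_* (+ c * s * + (d !))) suc-d ⟩
    + suc d * (+ c * s * + (d !))          ≡⟨ regroup (+ suc d) (+ c) s (+ (d !)) ⟩
    + c * s * (+ suc d * + (d !))          ≡⟨ cong (+ c * s *_) (ℤₚ.pos-* (suc d) (d !)) ⟨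
    + c * s * + (suc d !)                  ∎
  where
  s = -1ℤ ^ k
  d = m ∸ k
  c = suc d C k
  suc-d : + suc m - + k ≡ + suc d
  suc-d = begin
    + suc m - + k          ≡⟨ cong (λ x → + suc x - + k) (ℕₚ.m∸n+n≡m k≤m) ⟨
    + suc (d ℕ.+ k) - + k  ≡⟨ cong (λ x → 1ℤ + x - + k) (ℤₚ.pos-+ d k) ⟩
    1ℤ + (+ d + + k) - + k ≡⟨ cancel (+ d) (+ k) ⟩
    + suc d                ∎
    where
    cancel : ∀ d k → 1ℤ + (d + k) - k ≡ 1ℤ + d
    cancel = solve-∀
  regroup : ∀ x c s f → x * (c * s * f) ≡ c * s * (x * f)
  regroup = solve-∀

-- Of the `m` closed columns, `k` pairwise nonadjacent ones can be chosen in `(m + 1 - k) C k` ways.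
-- Counting the open column 1, the closed columns outside S have 1, 2, up to `m - k` columns outside
-- S to their left, so every product is `(m - k) !`. Barring the rightmost column replaces `m + 1`
-- by `m` in the binomial.
weight-initial : ∀ m k →
  weight (initial m) k ≡ + ((suc m ∸ k) C k) * (-1ℤ ^ k) * + ((m ∸ k) !)
weight∌-initial : ∀ m k →
  weight∌ (initial m) k ≡ + ((m ∸ k) C k) * (-1ℤ ^ k) * + ((m ∸ k) !)
weight-initial zero zero = refl
weight-initial zero (suc k) = sym (cong (λ c → + c * (-1ℤ ^ suc k) * 1ℤ)
  (k>n⇒nCk≡0 {0 ∸ k} {suc k} (ℕₚ.≤-<-trans (ℕₚ.m∸n≤m 0 k) (s≤s z≤n))))
weight-initial (suc m) zero = begin
  weight∌ (initial (suc m)) 0 - 0ℤ  ≡⟨ ℤₚ.+-identityʳ _ ⟩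
  weight∌ (initial (suc m)) 0       ≡⟨ weight∌-initial (suc m) 0 ⟩
  + (suc m C 0) * 1ℤ * + (suc m !)  ∎
weight-initial (suc m) (suc k) = begin
  weight∌ (initial (suc m)) (suc k) - weight∌ (initial m) k
    -- The sets S without and with the rightmost column give the two terms of Pascal's rule, with
    -- the same factorial.
    ≡⟨ cong₂ _-_ (weight∌-initial (suc m) (suc k)) (weight∌-initial m k) ⟩
  + ((m ∸ k) C suc k) * (-1ℤ * s) * d! - + ((m ∸ k) C k) * s * d!
    ≡⟨ regroup (+ ((m ∸ k) C suc k)) (+ ((m ∸ k) C k)) s d! ⟩
  (+ ((m ∸ k) C k) + + ((m ∸ k) C suc k)) * (-1ℤ * s) * d!
    ≡⟨ cong (λ c → c * (-1ℤ * s) * d!) (ℤₚ.pos-+ ((m ∸ k) C k) ((m ∸ k) C suc k)) ⟨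
  + ((m ∸ k) C k ℕ.+ (m ∸ k) C suc k) * (-1ℤ * s) * d!
    ≡⟨ cong (λ c → + c * (-1ℤ * s) * d!) pascal ⟩
  + ((suc m ∸ k) C suc k) * (-1ℤ * s) * d! ∎
  where
  s = -1ℤ ^ k
  d! = + ((m ∸ k) !)
  regroup : ∀ a b s d → a * (-1ℤ * s) * d - b * s * d ≡ (b + a) * (-1ℤ * s) * d
  regroup = solve-∀
  pascal : (m ∸ k) C k ℕ.+ (m ∸ k) C suc k ≡ (suc m ∸ k) C suc k
  pascal with k ℕₚ.≤? m
  ... | yes k≤m rewrite ℕₚ.+-∸-assoc 1 k≤m = nCk+nC[k+1]≡[n+1]C[k+1] (m ∸ k) k
  ... | no k≰m rewrite ℕₚ.m≤n⇒m∸n≡0 (ℕₚ.<⇒≤ (ℕₚ.≰⇒> k≰m)) | ℕₚ.m≤n⇒m∸n≡0 (ℕₚ.≰⇒> k≰m)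
      = cong (ℕ._+ (0 C suc k)) (k>n⇒nCk≡0 (ℕₚ.≤-<-trans z≤n (ℕₚ.≰⇒> k≰m)))
weight∌-initial zero zero = refl
weight∌-initial zero (suc k) = refl
weight∌-initial (suc m) k =
  trans (cong ((+ suc m - + k) *_) (weight-initial m k)) (absorb-factorial m k)

-- Counting matrices row by row

private variable
  X Y : Set

Σ∈ : List X → (X → ℤ) → ℤ
Σ∈ []       φ = 0ℤ
Σ∈ (x ∷ xs) φ = φ x + Σ∈ xs φ

[_]·_ : Bool → ℤ → ℤ
[ b ]· x = if b then x else 0ℤ

[∧]· : ∀ a b x → [ a ∧ b ]· x ≡ [ a ]· ([ b ]· x)
[∧]· a b x = if-∧ a

Σ∈-cong : (xs : List X) {φ ψ : X → ℤ} → (∀ x → φ x ≡ ψ x) → Σ∈ xs φ ≡ Σ∈ xs ψ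
Σ∈-cong []       eq = refl
Σ∈-cong (x ∷ xs) eq = cong₂ _+_ (eq x) (Σ∈-cong xs eq)

Σ∈-zero : (xs : List X) → Σ∈ xs (λ _ → 0ℤ) ≡ 0ℤ
Σ∈-zero []       = refl
Σ∈-zero (x ∷ xs) = trans (ℤₚ.+-identityˡ _) (Σ∈-zero xs)

Σ∈-+ : (xs : List X) (φ ψ : X → ℤ) → Σ∈ xs (λ x → φ x + ψ x) ≡ Σ∈ xs φ + Σ∈ xs ψ
Σ∈-+ []       φ ψ = refl
Σ∈-+ (x ∷ xs) φ ψ = trans (cong (λ s → φ x + ψ x + s) (Σ∈-+ xs φ ψ)) (regroup (φ x) (ψ x) _ _)
  where
  regroup : ∀ a b c d → a + b + (c + d) ≡ (a + c) + (b + d)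
  regroup = solve-∀

Σ∈-[]· : ∀ b (xs : List X) (φ : X → ℤ) → Σ∈ xs (λ x → [ b ]· φ x) ≡ [ b ]· Σ∈ xs φ
Σ∈-[]· true  xs φ = refl
Σ∈-[]· false xs φ = Σ∈-zero xs

Σ∈-swap : (xs : List X) (ys : List Y) (φ : X → Y → ℤ) →
  Σ∈ xs (λ x → Σ∈ ys (φ x)) ≡ Σ∈ ys (λ y → Σ∈ xs (λ x → φ x y))
Σ∈-swap []       ys φ = sym (Σ∈-zero ys)
Σ∈-swap (x ∷ xs) ys φ =
  trans (cong (λ s → Σ∈ ys (φ x) + s) (Σ∈-swap xs ys φ)) (sym (Σ∈-+ ys (φ x) _))

Σ∈-++ : (xs ys : List X) (φ : X → ℤ) → Σ∈ (xs ++ ys) φ ≡ Σ∈ xs φ + Σ∈ ys φ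
Σ∈-++ []       ys φ = sym (ℤₚ.+-identityˡ _)
Σ∈-++ (x ∷ xs) ys φ = trans (cong (λ s → φ x + s) (Σ∈-++ xs ys φ)) (sym (ℤₚ.+-assoc (φ x) _ _))

Σ∈-map : (g : X → Y) (xs : List X) (φ : Y → ℤ) → Σ∈ (List.map g xs) φ ≡ Σ∈ xs (φ ∘ g)
Σ∈-map g []       φ = refl
Σ∈-map g (x ∷ xs) φ = cong (λ s → φ (g x) + s) (Σ∈-map g xs φ)

Σ∈-vectors : (xs : List X) (n : ℕ) (φ : Vec X (suc n) → ℤ) →
  Σ∈ (vectors xs (suc n)) φ ≡ Σ∈ xs (λ x → Σ∈ (vectors xs n) (λ v → φ (x ∷ v)))
Σ∈-vectors xs n φ = go xs
  where
  go : ∀ zs → Σ∈ (cartesianProductWith _∷_ zs (vectors xs n)) φ ≡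
              Σ∈ zs (λ x → Σ∈ (vectors xs n) (λ v → φ (x ∷ v)))
  go []       = refl
  go (z ∷ zs) = trans (Σ∈-++ (List.map (z ∷_) (vectors xs n)) _ φ)
                      (cong₂ _+_ (Σ∈-map (z ∷_) (vectors xs n) φ) (go zs))

length-filter≡Σ∈ : {P : Pred X 0ℓ} (P? : Decidable P) (xs : List X) →
  + length (filter P? xs) ≡ Σ∈ xs (λ x → [ does (P? x) ]· 1ℤ)
length-filter≡Σ∈ P? []       = refl
length-filter≡Σ∈ P? (x ∷ xs) with does (P? x)
... | true  = cong (λ s → 1ℤ + s) (length-filter≡Σ∈ P? xs)
... | false = trans (length-filter≡Σ∈ P? xs) (sym (ℤₚ.+-identityˡ _))

-- Serves to reverse all rows of a matrix at once: invariance passes from one row to all of them,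
-- row after row.
Σ∈-vectors-map : (g : X → X) (xs : List X) → (∀ φ → Σ∈ xs (φ ∘ g) ≡ Σ∈ xs φ) →
  ∀ n φ → Σ∈ (vectors xs n) (φ ∘ map g) ≡ Σ∈ (vectors xs n) φ
Σ∈-vectors-map g xs inv zero    φ = refl
Σ∈-vectors-map g xs inv (suc n) φ = begin
  Σ∈ (vectors xs (suc n)) (φ ∘ map g)
    ≡⟨ Σ∈-vectors xs n (φ ∘ map g) ⟩
  Σ∈ xs (λ x → Σ∈ (vectors xs n) (λ v → φ (g x ∷ map g v)))
    ≡⟨ Σ∈-cong xs (λ x → Σ∈-vectors-map g xs inv n (λ v → φ (g x ∷ v))) ⟩
  Σ∈ xs (λ x → Σ∈ (vectors xs n) (λ v → φ (g x ∷ v)))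
    ≡⟨ inv (λ x → Σ∈ (vectors xs n) (λ v → φ (x ∷ v))) ⟩
  Σ∈ xs (λ x → Σ∈ (vectors xs n) (λ v → φ (x ∷ v)))
    ≡⟨ Σ∈-vectors xs n φ ⟨
  Σ∈ (vectors xs (suc n)) φ ∎

Σ∈-vectors-∷ʳ : (xs : List X) (n : ℕ) (φ : Vec X (suc n) → ℤ) →
  Σ∈ xs (λ x → Σ∈ (vectors xs n) (λ v → φ (v ∷ʳ x))) ≡ Σ∈ (vectors xs (suc n)) φ
Σ∈-vectors-∷ʳ xs zero    φ = sym (Σ∈-vectors xs zero φ)
Σ∈-vectors-∷ʳ xs (suc n) φ = begin
  Σ∈ xs (λ x → Σ∈ (vectors xs (suc n)) (λ v → φ (v ∷ʳ x)))
    ≡⟨ Σ∈-cong xs (λ x → Σ∈-vectors xs n (λ v → φ (v ∷ʳ x))) ⟩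
  Σ∈ xs (λ x → Σ∈ xs (λ y → Σ∈ (vectors xs n) (λ v → φ (y ∷ (v ∷ʳ x)))))
    ≡⟨ Σ∈-swap xs xs _ ⟩
  Σ∈ xs (λ y → Σ∈ xs (λ x → Σ∈ (vectors xs n) (λ v → φ (y ∷ (v ∷ʳ x)))))
    ≡⟨ Σ∈-cong xs (λ y → Σ∈-vectors-∷ʳ xs n (λ v → φ (y ∷ v))) ⟩
  Σ∈ xs (λ y → Σ∈ (vectors xs (suc n)) (λ v → φ (y ∷ v)))
    ≡⟨ Σ∈-vectors xs (suc n) φ ⟨
  Σ∈ (vectors xs (suc (suc n))) φ ∎

Σ∈-vectors-reverse : (xs : List X) (n : ℕ) (φ : Vec X n → ℤ) →
  Σ∈ (vectors xs n) (φ ∘ reverse) ≡ Σ∈ (vectors xs n) φ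
Σ∈-vectors-reverse xs zero    φ = refl
Σ∈-vectors-reverse xs (suc n) φ = begin
  Σ∈ (vectors xs (suc n)) (φ ∘ reverse)
    ≡⟨ Σ∈-vectors xs n (φ ∘ reverse) ⟩
  Σ∈ xs (λ x → Σ∈ (vectors xs n) (λ v → φ (reverse (x ∷ v))))
    ≡⟨ Σ∈-cong xs (λ x → Σ∈-cong (vectors xs n) (λ v → cong φ (reverse-∷ x v))) ⟩
  Σ∈ xs (λ x → Σ∈ (vectors xs n) (λ v → φ (reverse v ∷ʳ x)))
    ≡⟨ Σ∈-cong xs (λ x → Σ∈-vectors-reverse xs n (λ v → φ (v ∷ʳ x))) ⟩
  Σ∈ xs (λ x → Σ∈ (vectors xs n) (λ v → φ (v ∷ʳ x)))
    ≡⟨ Σ∈-vectors-∷ʳ xs n φ ⟩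
  Σ∈ (vectors xs (suc n)) φ ∎

-- States, admissible rows and the recursion for completions

bits : ∀ n → List (Vec Bool n)
bits = vectors (false ∷ true ∷ [])

Σ∈-bits : ∀ n (φ : Vec Bool (suc n) → ℤ) →
  Σ∈ (bits (suc n)) φ ≡ Σ∈ (bits n) (φ ∘ (false ∷_)) + Σ∈ (bits n) (φ ∘ (true ∷_))
Σ∈-bits n φ = trans (Σ∈-vectors (false ∷ true ∷ []) n φ)
                    (cong (λ s → Σ∈ (bits n) (φ ∘ (false ∷_)) + s) (ℤₚ.+-identityʳ _))

nonzero : ∀ {m} → Vec Bool m → Bool
nonzero []      = false
nonzero (b ∷ r) = b ∨ nonzero r

-- The empty row passes because the bottom row, cut down to its antidiagonal entry, has no entry on
-- the second diagonal.
headZero : ∀ {m} → Vec Bool m → Bool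
headZero []      = true
headZero (b ∷ r) = not b

headsZero : ∀ {k m} → Vec (Vec Bool m) k → Bool
headsZero []       = true
headsZero (r ∷ rs) = headZero r ∧ headsZero rs

-- With columns reversed, the entries to the left of `b` are those of `r`: `nonzero r` asks for a
-- vertex on the left, `o` for an open column.
xorRow : ∀ {m} → Vec Bool m → Vec Bool m → Bool
xorRow []      []      = true
xorRow (o ∷ O) (b ∷ r) = (not b ∨ (o xor nonzero r)) ∧ xorRow O r

oneZero : ∀ {m} → Vec Bool (suc m) → Bool
oneZero (b ∷ r) = b ∧ headZero r

-- Columns are reversed, so that the antidiagonal becomes the main diagonal and the
-- support is upper triangular; after its first row, the first column is empty and
-- both are stripped. The state O marks the columns with a vertex higher up.
fits : ∀ {m} → Vec Bool m → Matrix m → Bool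
fits {zero}  O []       = true
fits {suc m} O (r ∷ rs) =
  (oneZero r ∧ xorRow O r) ∧ (headsZero rs ∧ fits (tail (zipWith _∨_ O r)) (map tail rs))

completions : ∀ {m} → Vec Bool m → ℤ
completions {m} O = Σ∈ (matrices m) (λ M → [ fits O M ]· 1ℤ)

-- Deleting an empty first column is a bijection; a row that starts with 1 contributes 0.
Σ∈-headsZero : ∀ k m (φ : Vec (Vec Bool m) k → ℤ) →
  Σ∈ (vectors (bits (suc m)) k) (λ M → [ headsZero M ]· φ (map tail M)) ≡ Σ∈ (vectors (bits m) k) φ
Σ∈-headsZero zero    m φ = refl
Σ∈-headsZero (suc k) m φ = begin
  Σ∈ (vectors (bits (suc m)) (suc k)) (λ M → [ headsZero M ]· φ (map tail M))
    ≡⟨ Σ∈-vectors (bits (suc m)) k _ ⟩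
  Σ∈ (bits (suc m)) (λ r → Σ∈ Ms (λ M → [ headsZero (r ∷ M) ]· φ (tail r ∷ map tail M)))
    ≡⟨ Σ∈-bits m _ ⟩
  Σ∈ (bits m) (λ r → Σ∈ Ms (λ M → [ headsZero M ]· φ (r ∷ map tail M))) +
  Σ∈ (bits m) (λ r → Σ∈ Ms (λ M → 0ℤ))
    ≡⟨ cong₂ _+_ (Σ∈-cong (bits m) (λ r → Σ∈-headsZero k m (λ M → φ (r ∷ M))))
                 (trans (Σ∈-cong (bits m) (λ r → Σ∈-zero Ms)) (Σ∈-zero (bits m))) ⟩
  Σ∈ (bits m) (λ r → Σ∈ (vectors (bits m) k) (λ M → φ (r ∷ M))) + 0ℤ
    ≡⟨ ℤₚ.+-identityʳ _ ⟩
  Σ∈ (bits m) (λ r → Σ∈ (vectors (bits m) k) (λ M → φ (r ∷ M)))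
    ≡⟨ Σ∈-vectors (bits m) k φ ⟨
  Σ∈ (vectors (bits m) (suc k)) φ ∎
  where
  Ms : List (Vec (Vec Bool (suc m)) k)
  Ms = vectors (bits (suc m)) k

-- The rows below depend on the top row `r` only through the updated state, so their sum is
-- `completions` of that state.
completions-row : ∀ {m} (O : Vec Bool (suc m)) →
  completions O ≡
  Σ∈ (bits (suc m)) (λ r → [ oneZero r ∧ xorRow O r ]· completions (tail (zipWith _∨_ O r)))
completions-row {m} O =
  trans (Σ∈-vectors (bits (suc m)) m (λ M → [ fits O M ]· 1ℤ))
        (Σ∈-cong (bits (suc m)) firstRow)
  where
  Ms : List (Vec (Vec Bool (suc m)) m)
  Ms = vectors (bits (suc m)) m
  firstRow : ∀ r → Σ∈ Ms (λ M → [ fits O (r ∷ M) ]· 1ℤ) ≡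
              [ oneZero r ∧ xorRow O r ]· completions (tail (zipWith _∨_ O r))
  firstRow r = begin
    Σ∈ Ms (λ M → [ a ∧ (headsZero M ∧ fits O′ (map tail M)) ]· 1ℤ)
      ≡⟨ Σ∈-cong Ms (λ M → trans ([∧]· a _ 1ℤ) (cong ([ a ]·_) ([∧]· (headsZero M) _ 1ℤ))) ⟩
    Σ∈ Ms (λ M → [ a ]· ([ headsZero M ]· ([ fits O′ (map tail M) ]· 1ℤ)))
      ≡⟨ Σ∈-[]· a Ms _ ⟩
    [ a ]· Σ∈ Ms (λ M → [ headsZero M ]· ([ fits O′ (map tail M) ]· 1ℤ))
      ≡⟨ cong ([ a ]·_) (Σ∈-headsZero m m (λ M → [ fits O′ M ]· 1ℤ)) ⟩
    [ a ]· completions O′ ∎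
    where
    a  = oneZero r ∧ xorRow O r
    O′ = tail (zipWith _∨_ O r)

-- The row without vertices passes `xorRow` vacuously and does not change the state, so exactly one
-- summand survives.
Σ∈-zeroRow : ∀ {m} (O : Vec Bool m) (φ : Vec Bool m → ℤ) →
  Σ∈ (bits m) (λ r → [ not (nonzero r) ∧ xorRow O r ]· φ (zipWith _∨_ O r)) ≡ φ O
Σ∈-zeroRow []      φ = ℤₚ.+-identityʳ _
Σ∈-zeroRow {suc m} (o ∷ O) φ = begin
  Σ∈ (bits (suc m)) (λ r → [ not (nonzero r) ∧ xorRow (o ∷ O) r ]· φ (zipWith _∨_ (o ∷ O) r))
    ≡⟨ Σ∈-bits m _ ⟩
  Σ∈ (bits m) (λ r → [ not (nonzero r) ∧ xorRow O r ]· φ ((o ∨ false) ∷ zipWith _∨_ O r)) +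
  Σ∈ (bits m) (λ r → 0ℤ)
    ≡⟨ cong₂ _+_ (Σ∈-zeroRow O (φ ∘ ((o ∨ false) ∷_))) (Σ∈-zero (bits m)) ⟩
  φ ((o ∨ false) ∷ O) + 0ℤ
    ≡⟨ ℤₚ.+-identityʳ _ ⟩
  φ ((o ∨ false) ∷ O)
    ≡⟨ cong (λ o → φ (o ∷ O)) (∨-identityʳ o) ⟩
  φ (o ∷ O) ∎

Σ∈-rowMeeting : ∀ {m} (O : Vec Bool m) (φ : Vec Bool m → ℤ) →
  Σ∈ (bits m) (λ r → [ nonzero r ∧ xorRow O r ]· φ (zipWith _∨_ O r)) ≡ ΣrowMeeting O φ
Σ∈-rowMeeting []          φ = refl
-- A vertex in an open column has no vertex to its left, which leaves only the zero row for `O`.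
Σ∈-rowMeeting {suc m} (true  ∷ O) φ =
  trans (Σ∈-bits m _) (cong₂ _+_ (Σ∈-rowMeeting O (φ ∘ (true ∷_))) (Σ∈-zeroRow O (φ ∘ (true ∷_))))
Σ∈-rowMeeting {suc m} (false ∷ O) φ =
  trans (Σ∈-bits m _) (cong₂ _+_ (Σ∈-rowMeeting O (φ ∘ (false ∷_))) (Σ∈-rowMeeting O (φ ∘ (true ∷_))))

-- The antidiagonal vertex of the top row lies in an open column, so it is the only vertex of that
-- row and no other column opens.
completions-true : ∀ {m} (O : Vec Bool m) → completions (true ∷ O) ≡ completions O
completions-true {m} O = begin
  completions (true ∷ O)
    ≡⟨ completions-row (true ∷ O) ⟩
  Σ∈ (bits (suc m)) _
    ≡⟨ Σ∈-bits m _ ⟩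
  Σ∈ (bits m) (λ r → 0ℤ) +
  Σ∈ (bits m) (λ r → [ headZero r ∧ (not (nonzero r) ∧ xorRow O r) ]· completions (zipWith _∨_ O r))
    ≡⟨ cong₂ _+_ (Σ∈-zero (bits m))
         (trans (Σ∈-cong (bits m) (λ r → cong ([_]· completions (zipWith _∨_ O r)) (absorb r (xorRow O r))))
                (Σ∈-zeroRow O completions)) ⟩
  0ℤ + completions O
    ≡⟨ ℤₚ.+-identityˡ _ ⟩
  completions O ∎
  where
  absorb : ∀ {m} (r : Vec Bool m) x → headZero r ∧ (not (nonzero r) ∧ x) ≡ not (nonzero r) ∧ x
  absorb []          x = refl
  absorb (true  ∷ r) x = refl
  absorb (false ∷ r) x = refl

-- The antidiagonal vertex lies in a closed column and needs a vertex to its left. The second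
-- diagonal is 0 in column `o`, so that vertex lies in `O` and `o` is unchanged.
completions-false : ∀ {m} o (O : Vec Bool m) →
  completions (false ∷ o ∷ O) ≡ ΣrowMeeting O (λ P → completions (o ∷ P))
completions-false {m} o O = begin
  completions (false ∷ o ∷ O)
    ≡⟨ completions-row (false ∷ o ∷ O) ⟩
  Σ∈ (bits (suc (suc m))) _
    ≡⟨ Σ∈-bits (suc m) _ ⟩
  Σ∈ (bits (suc m)) (λ r → 0ℤ) +
  Σ∈ (bits (suc m)) (λ r → [ headZero r ∧ (nonzero r ∧ xorRow (o ∷ O) r) ]·
                           completions (zipWith _∨_ (o ∷ O) r))
    ≡⟨ cong₂ _+_ (Σ∈-zero (bits (suc m))) (Σ∈-bits m _) ⟩
  0ℤ + (Σ∈ (bits m) (λ r → [ nonzero r ∧ xorRow O r ]· completions ((o ∨ false) ∷ zipWith _∨_ O r)) +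
        Σ∈ (bits m) (λ r → 0ℤ))
    ≡⟨ cong (λ s → 0ℤ + s) (cong₂ _+_ (Σ∈-rowMeeting O (λ P → completions ((o ∨ false) ∷ P))) (Σ∈-zero (bits m))) ⟩
  0ℤ + (ΣrowMeeting O (λ P → completions ((o ∨ false) ∷ P)) + 0ℤ)
    ≡⟨ trans (ℤₚ.+-identityˡ _) (ℤₚ.+-identityʳ _) ⟩
  ΣrowMeeting O (λ P → completions ((o ∨ false) ∷ P))
    ≡⟨ cong (λ o → ΣrowMeeting O (λ P → completions (o ∷ P))) (∨-identityʳ o) ⟩
  ΣrowMeeting O (λ P → completions (o ∷ P)) ∎

Σ<-zero : ∀ n {t : ℕ → ℤ} → (∀ k → t k ≡ 0ℤ) → Σ< n t ≡ 0ℤ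
Σ<-zero zero    eq = refl
Σ<-zero (suc n) {t} eq =
  trans (Σ<-suc n t) (cong₂ _+_ (eq 0) (Σ<-zero n (eq ∘ suc)))

-- Both sides obey the same recursion. The bound `n` is separate from the length so that the range
-- of summation stays fixed while columns are dropped.
completions≡Σweight : ∀ {m n} (O : Vec Bool m) → m ≤ n → completions O ≡ Σ< (suc n) (weight O)
completions≡Σweight {n = n} [] _ = sym (begin
  Σ< (suc n) (weight [])              ≡⟨ Σ<-suc n (weight []) ⟩
  1ℤ + Σ< n (weight [] ∘ suc)         ≡⟨ cong (λ s → 1ℤ + s) (Σ<-zero n (λ _ → refl)) ⟩
  1ℤ                                  ∎)
completions≡Σweight (true ∷ O) m<n =
  trans (completions-true O) (completions≡Σweight O (ℕₚ.<⇒≤ m<n))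
-- The antidiagonal vertex of a single closed column has nothing above or to the left, so there is
-- no completion; the weights vanish as well, in degree 0 through the factor `0 - 0`.
completions≡Σweight {n = n} (false ∷ []) _ = sym (Σ<-zero (suc n) {weight (false ∷ [])} λ
  { zero          → refl
  ; (suc zero)    → refl
  ; (suc (suc k)) → cong (λ x → x - 0ℤ) (ℤₚ.*-zeroʳ (0ℤ - + suc (suc k))) })
completions≡Σweight {n = n} (false ∷ o ∷ O) m<n = begin
  completions (false ∷ o ∷ O)
    ≡⟨ completions-false o O ⟩
  ΣrowMeeting O (λ P → completions (o ∷ P))
    ≡⟨ ΣrowMeeting-cong O (λ P → completions≡Σweight (o ∷ P) (ℕₚ.<⇒≤ m<n)) ⟩
  ΣrowMeeting O (λ P → Σ< (suc n) (weight (o ∷ P)))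
    ≡⟨ ΣrowMeeting-Σweight n o O m<n ⟩
  Σ< (suc n) (weight (false ∷ o ∷ O)) ∎

-- Row conditions in terms of positions

∧-true : ∀ {a b} → a ∧ b ≡ true ⇔ (a ≡ true × b ≡ true)
∧-true {a} {b} = mk⇔ (λ e → ∧-conicalˡ a b e , ∧-conicalʳ a b e) (λ { (refl , refl) → refl })

∨-true : ∀ {a b} → a ∨ b ≡ true ⇔ (a ≡ true ⊎ b ≡ true)
∨-true {true}  = mk⇔ (λ _ → inj₁ refl) (λ _ → refl)
∨-true {false} = mk⇔ inj₂ (λ { (inj₁ ()) ; (inj₂ e) → e })

xor-true : ∀ {a b} → a xor b ≡ true ⇔ ExactlyOneOf (a ≡ true) (b ≡ true)
xor-true {true}  {true}  = mk⇔ (λ ()) (λ { (inj₁ (_ , ¬b)) → contradiction refl ¬b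
                                         ; (inj₂ (¬a , _)) → contradiction refl ¬a })
xor-true {true}  {false} = mk⇔ (λ _ → inj₁ (refl , λ ())) (λ _ → refl)
xor-true {false} {true}  = mk⇔ (λ _ → inj₂ ((λ ()) , refl)) (λ _ → refl)
xor-true {false} {false} = mk⇔ (λ ()) (λ { (inj₁ (() , _)) ; (inj₂ (_ , ())) })

exactlyOneOf-cong : ∀ {A A′ B B′} → A ⇔ A′ → B ⇔ B′ → ExactlyOneOf A B ⇔ ExactlyOneOf A′ B′
exactlyOneOf-cong e f = mk⇔ (half e f) (half (⇔-sym e) (⇔-sym f))
  where
  half : ∀ {A A′ B B′} → A ⇔ A′ → B ⇔ B′ → ExactlyOneOf A B → ExactlyOneOf A′ B′
  half e f (inj₁ (a , ¬b)) = inj₁ (to e a , ¬b ∘ from f)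
  half e f (inj₂ (¬a , b)) = inj₂ (¬a ∘ from e , to f b)

nonzero-true : ∀ {m} (r : Vec Bool m) → nonzero r ≡ true ⇔ (∃ λ j → lookup r j ≡ true)
nonzero-true []      = mk⇔ (λ ()) (λ ())
nonzero-true (b ∷ r) = mk⇔ there here ⇔-∘ ∨-true
  where
  there : b ≡ true ⊎ nonzero r ≡ true → ∃ λ j → lookup (b ∷ r) j ≡ true
  there (inj₁ e) = zero , e
  there (inj₂ e) with j , v ← to (nonzero-true r) e = suc j , v
  here : (∃ λ j → lookup (b ∷ r) j ≡ true) → b ≡ true ⊎ nonzero r ≡ true
  here (zero  , e) = inj₁ e
  here (suc j , e) = inj₂ (from (nonzero-true r) (j , e))

XorAt : ∀ {m} → Vec Bool m → Vec Bool m → Fin m → Set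
XorAt O r j = lookup r j ≡ true →
  ExactlyOneOf (lookup O j ≡ true) (∃ λ j′ → j Fin.< j′ × lookup r j′ ≡ true)

xorRow-true : ∀ {m} (O r : Vec Bool m) → xorRow O r ≡ true ⇔ (∀ j → XorAt O r j)
xorRow-true []      []      = mk⇔ (λ _ ()) (λ _ → refl)
xorRow-true {suc m} (o ∷ O) (b ∷ r) = mk⇔ fwd bwd
  where
  later : nonzero r ≡ true ⇔ (∃ λ j′ → zero {m} Fin.< j′ × lookup (b ∷ r) j′ ≡ true)
  later = mk⇔ (λ { (j , v) → suc j , s≤s z≤n , v }) (λ { (suc j , _ , v) → j , v }) ⇔-∘ nonzero-true r
  shiftʳ : ∀ {j} → (∃ λ j′ → j Fin.< j′ × lookup r j′ ≡ true) ⇔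
                   (∃ λ j′ → suc j Fin.< j′ × lookup (b ∷ r) j′ ≡ true)
  shiftʳ = mk⇔ (λ { (j , l , v) → suc j , s≤s l , v }) (λ { (suc j , s≤s l , v) → j , l , v })
  head⇔ : not b ∨ (o xor nonzero r) ≡ true ⇔ XorAt (o ∷ O) (b ∷ r) zero
  head⇔ = lemma b refl
    where
    e : o xor nonzero r ≡ true ⇔ ExactlyOneOf (o ≡ true) (∃ λ j′ → zero {m} Fin.< j′ × lookup (b ∷ r) j′ ≡ true)
    e = exactlyOneOf-cong (mk⇔ id id) later ⇔-∘ xor-true
    lemma : ∀ c → c ≡ b → not c ∨ (o xor nonzero r) ≡ true ⇔ XorAt (o ∷ O) (b ∷ r) zero
    lemma true  refl = mk⇔ (λ h _ → to e h) (λ h → from e (h refl))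
    lemma false refl = mk⇔ (λ _ ()) (λ _ → refl)
  fwd : xorRow (o ∷ O) (b ∷ r) ≡ true → ∀ j → XorAt (o ∷ O) (b ∷ r) j
  fwd h zero      = to head⇔ (proj₁ (to ∧-true h))
  fwd h (suc j) v = to (exactlyOneOf-cong (mk⇔ id id) shiftʳ)
                       (to (xorRow-true O r) (proj₂ (to (∧-true {not b ∨ (o xor nonzero r)}) h)) j v)
  bwd : (∀ j → XorAt (o ∷ O) (b ∷ r) j) → xorRow (o ∷ O) (b ∷ r) ≡ true
  bwd h = from ∧-true (from head⇔ (h zero) ,
                       from (xorRow-true O r) (λ j v → from (exactlyOneOf-cong (mk⇔ id id) shiftʳ) (h (suc j) v)))

headsZero-true : ∀ {k m} (rs : Vec (Vec Bool (suc m)) k) →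
  headsZero rs ≡ true ⇔ (∀ i → lookup (lookup rs i) zero ≡ false)
headsZero-true []             = mk⇔ (λ _ ()) (λ _ → refl)
headsZero-true ((true  ∷ r) ∷ rs) = mk⇔ (λ ()) (λ h → contradiction (h zero) λ ())
headsZero-true ((false ∷ r) ∷ rs) =
  mk⇔ (λ { h zero → refl ; h (suc i) → to (headsZero-true rs) h i })
      (λ h → from (headsZero-true rs) (h ∘ suc))

Right : ∀ {n} → Matrix n → Pos n → Fin n → Set
Right U (i , j) j′ = j Fin.< j′ × Vertex U (i , j′)

-- The state records rows already removed, so the notion is stable when the top row of `U` is moved
-- into `O`.
Opened : ∀ {n} → Vec Bool n → Matrix n → Pos n → Set
Opened O U p = lookup O (proj₂ p) ≡ true ⊎ ∃ (Above U p)

-- Positional form of the test `fits`. Under reversal the second diagonal is the superdiagonal, and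
-- left becomes right.
record Staircase {n} (O : Vec Bool n) (U : Matrix n) : Set where
  field
    below     : ∀ i j → j Fin.< i → entry U (i , j) ≡ false
    diagonal  : ∀ i j → i ≡ j → Vertex U (i , j)
    second    : ∀ i j → toℕ j ≡ suc (toℕ i) → entry U (i , j) ≡ false
    exclusive : ∀ i j → Vertex U (i , j) → ExactlyOneOf (Opened O U (i , j)) (∃ (Right U (i , j)))

module _ {m} (o b : Bool) (O r : Vec Bool m) (rs : Vec (Vec Bool (suc m)) m) where

  private
    U : Matrix (suc m)
    U = (b ∷ r) ∷ rs
    O′ : Vec Bool m
    O′ = zipWith _∨_ O r
    U′ : Matrix m
    U′ = map tail rs

  entry-tail : ∀ i j → entry U′ (i , j) ≡ entry U (suc i , suc j)
  entry-tail i j = trans (cong (λ r → lookup r j) (lookup-map i tail rs)) (lookup-tail (lookup rs i))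
    where
    lookup-tail : ∀ (r : Vec Bool (suc m)) → lookup (tail r) j ≡ lookup r (suc j)
    lookup-tail (x ∷ r) = refl

  vertex-tail : ∀ {i j} → Vertex U′ (i , j) ⇔ Vertex U (suc i , suc j)
  vertex-tail {i} {j} = mk⇔ (trans (sym (entry-tail i j))) (trans (entry-tail i j))

  -- Only the witness moves: a vertex of the removed row `r` becomes a mark in `O′`.
  opened-tail : ∀ i j → Opened O′ U′ (i , j) ⇔ Opened (o ∷ O) U (suc i , suc j)
  opened-tail i j = mk⇔ fwd bwd
    where
    state : lookup O′ j ≡ true ⇔ (lookup O j ≡ true ⊎ lookup r j ≡ true)
    state = ∨-true ⇔-∘ mk⇔ (trans (sym (lookup-zipWith _∨_ j O r))) (trans (lookup-zipWith _∨_ j O r))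
    fwd : Opened O′ U′ (i , j) → Opened (o ∷ O) U (suc i , suc j)
    fwd (inj₁ e)            = Sum.map₂ (λ v → zero , s≤s z≤n , v) (to state e)
    fwd (inj₂ (i′ , l , v)) = inj₂ (suc i′ , s≤s l , to vertex-tail v)
    bwd : Opened (o ∷ O) U (suc i , suc j) → Opened O′ U′ (i , j)
    bwd (inj₁ e)                    = inj₁ (from state (inj₁ e))
    bwd (inj₂ (zero   , _     , v)) = inj₁ (from state (inj₂ v))
    bwd (inj₂ (suc i′ , s≤s l , v)) = inj₂ (i′ , l , from vertex-tail v)

  right-tail : ∀ i j → ∃ (Right U′ (i , j)) ⇔ ∃ (Right U (suc i , suc j))
  right-tail i j = mk⇔ (λ { (j′ , l , v) → suc j′ , s≤s l , to vertex-tail v })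
                       (λ { (suc j′ , s≤s l , v) → j′ , l , from vertex-tail v })

  exclusive-tail : ∀ i j →
    ExactlyOneOf (Opened O′ U′ (i , j)) (∃ (Right U′ (i , j))) ⇔
    ExactlyOneOf (Opened (o ∷ O) U (suc i , suc j)) (∃ (Right U (suc i , suc j)))
  exclusive-tail i j = exactlyOneOf-cong (opened-tail i j) (right-tail i j)

  opened-top : ∀ j → lookup (o ∷ O) j ≡ true ⇔ Opened (o ∷ O) U (zero , j)
  opened-top j = mk⇔ inj₁ (λ { (inj₁ e) → e ; (inj₂ (_ , () , _)) })

  staircase-∷ : b ≡ true → headZero r ≡ true → xorRow (o ∷ O) (b ∷ r) ≡ true →
    headsZero rs ≡ true → Staircase O′ U′ → Staircase (o ∷ O) U
  staircase-∷ b≡1 r₀≡0 xors heads S = record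
    { below     = λ { (suc i) zero    _       → to (headsZero-true rs) heads i
                    ; (suc i) (suc j) (s≤s l) → trans (sym (entry-tail i j)) (S.below i j l) }
    ; diagonal  = λ { zero    zero    _ → b≡1
                    ; (suc i) (suc j) e → to vertex-tail (S.diagonal i j (Finₚ.suc-injective e)) }
    ; second    = λ { zero    (suc j) e → first r r₀≡0 j (ℕₚ.suc-injective e)
                    ; (suc i) (suc j) e → trans (sym (entry-tail i j)) (S.second i j (ℕₚ.suc-injective e)) }
    ; exclusive = λ { zero    j       v → to (exactlyOneOf-cong (opened-top j) (mk⇔ id id))
                                             (to (xorRow-true (o ∷ O) (b ∷ r)) xors j v)
                    ; (suc i) zero    v → contradiction v (not-¬ (to (headsZero-true rs) heads i))
                    ; (suc i) (suc j) v → to (exclusive-tail i j) (S.exclusive i j (from vertex-tail v)) } }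
    where
    module S = Staircase S
    first : ∀ {m} (r : Vec Bool m) → headZero r ≡ true → ∀ j → toℕ j ≡ 0 → lookup r j ≡ false
    first (false ∷ r) _ zero _ = refl

  staircase-uncons : Staircase (o ∷ O) U →
    b ≡ true × headZero r ≡ true × xorRow (o ∷ O) (b ∷ r) ≡ true × headsZero rs ≡ true × Staircase O′ U′
  staircase-uncons S =
      S.diagonal zero zero refl
    , first r (λ j e → S.second zero (suc j) (cong suc e))
    , from (xorRow-true (o ∷ O) (b ∷ r))
        (λ j v → from (exactlyOneOf-cong (opened-top j) (mk⇔ id id)) (S.exclusive zero j v))
    , from (headsZero-true rs) (λ i → S.below (suc i) zero (s≤s z≤n))
    , record
      { below     = λ i j l → trans (entry-tail i j) (S.below (suc i) (suc j) (s≤s l))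
      ; diagonal  = λ i j e → from vertex-tail (S.diagonal (suc i) (suc j) (cong suc e))
      ; second    = λ i j e → trans (entry-tail i j) (S.second (suc i) (suc j) (cong suc e))
      ; exclusive = λ i j v → from (exclusive-tail i j) (S.exclusive (suc i) (suc j) (to vertex-tail v)) }
    where
    module S = Staircase S
    first : ∀ {m} (r : Vec Bool m) → (∀ j → toℕ j ≡ 0 → lookup r j ≡ false) → headZero r ≡ true
    first []      _ = refl
    first (c ∷ r) h = cong not (h zero refl)

fits-true : ∀ {m} (O : Vec Bool m) (U : Matrix m) → fits O U ≡ true ⇔ Staircase O U
fits-true [] [] = mk⇔ (λ _ → record { below = λ () ; diagonal = λ () ; second = λ () ; exclusive = λ () })
                      (λ _ → refl)
fits-true (o ∷ O) ((b ∷ r) ∷ rs) = mk⇔ fwd bwd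
  where
  fwd : fits (o ∷ O) ((b ∷ r) ∷ rs) ≡ true → Staircase (o ∷ O) ((b ∷ r) ∷ rs)
  fwd h with p , q ← to (∧-true {(b ∧ headZero r) ∧ xorRow (o ∷ O) (b ∷ r)}) h
        with p₁ , xors ← to (∧-true {b ∧ headZero r}) p
        with b≡1 , r₀≡0 ← to (∧-true {b}) p₁
        with heads , rest ← to (∧-true {headsZero rs}) q
    = staircase-∷ o b O r rs b≡1 r₀≡0 xors heads (to (fits-true _ _) rest)
  bwd : Staircase (o ∷ O) ((b ∷ r) ∷ rs) → fits (o ∷ O) ((b ∷ r) ∷ rs) ≡ true
  bwd S with b≡1 , r₀≡0 , xors , heads , S′ ← staircase-uncons o b O r rs S
    = from ∧-true (from ∧-true (from ∧-true (b≡1 , r₀≡0) , xors) ,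
                   from ∧-true (heads , from (fits-true _ _) S′))

-- Upper-diagonal matrices

lookup-∷ʳ-fromℕ : ∀ {A : Set} {n} (xs : Vec A n) x → lookup (xs ∷ʳ x) (fromℕ n) ≡ x
lookup-∷ʳ-fromℕ []       x = refl
lookup-∷ʳ-fromℕ (y ∷ xs) x = lookup-∷ʳ-fromℕ xs x

lookup-∷ʳ-inject₁ : ∀ {A : Set} {n} (xs : Vec A n) x i → lookup (xs ∷ʳ x) (inject₁ i) ≡ lookup xs i
lookup-∷ʳ-inject₁ (y ∷ xs) x zero    = refl
lookup-∷ʳ-inject₁ (y ∷ xs) x (suc i) = lookup-∷ʳ-inject₁ xs x i

lookup-reverse-opposite : ∀ {A : Set} {n} (xs : Vec A n) i → lookup (reverse xs) (opposite i) ≡ lookup xs i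
lookup-reverse-opposite {n = suc n} (x ∷ xs) zero =
  trans (cong (λ v → lookup v (fromℕ n)) (reverse-∷ x xs)) (lookup-∷ʳ-fromℕ (reverse xs) x)
lookup-reverse-opposite (x ∷ xs) (suc i) =
  trans (cong (λ v → lookup v (inject₁ (opposite i))) (reverse-∷ x xs))
        (trans (lookup-∷ʳ-inject₁ (reverse xs) x (opposite i)) (lookup-reverse-opposite xs i))

lookup-initial-opposite : ∀ m j → lookup (initial m) (opposite j) ≡ true ⇔ suc (toℕ j) ≡ 1
lookup-initial-opposite m zero    = mk⇔ (λ _ → refl) (λ _ → lookup-∷ʳ-fromℕ (replicate m false) true)
lookup-initial-opposite m (suc j) = mk⇔ (λ e → contradiction e (not-¬ isFalse)) (λ ())
  where
  isFalse : lookup (initial m) (inject₁ (opposite j)) ≡ false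
  isFalse = trans (lookup-∷ʳ-inject₁ (replicate m false) true (opposite j)) (lookup-replicate (opposite j) false)

-- `opposite j` has two roles: the row in which column `j` meets the antidiagonal, and the place of
-- column `j` after reversal.
toℕ-opposite+ : ∀ {n} (j : Fin n) → toℕ (opposite j) ℕ.+ suc (toℕ j) ≡ n
toℕ-opposite+ {n} j = trans (cong (ℕ._+ suc (toℕ j)) (Finₚ.opposite-prop j)) (ℕₚ.m∸n+n≡m (Finₚ.toℕ<n j))

opposite-< : ∀ {n} {i j : Fin n} → i Fin.< j → opposite j Fin.< opposite i
opposite-< {n} {i} {j} i<j =
  subst₂ _<_ (sym (Finₚ.opposite-prop j)) (sym (Finₚ.opposite-prop i))
         (ℕₚ.∸-monoʳ-< (s≤s i<j) (Finₚ.toℕ<n j))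

-- Lets a claim about columns of the reversed matrix be checked at `opposite j`, the form to which
-- `entry-reverse` applies.
opposite-surjective : ∀ {n} {Q : Fin n → Set} → (∀ j → Q (opposite j)) → ∀ j → Q j
opposite-surjective {Q = Q} h j = subst Q (Finₚ.opposite-involutive j) (h (opposite j))

-- Describes the counted matrices without parents or leaves. In `exclusive`, `col p ≡ 1` stands for
-- column 1 being open from the start, so the origin is no exception.
record Diagonalized {n} (M : Matrix n) : Set where
  field
    beyond    : ∀ p → suc n < row p ℕ.+ col p → entry M p ≡ false
    antidiag  : ∀ p → row p ℕ.+ col p ≡ suc n → Vertex M p
    second    : ZeroSecondDiagonal M
    exclusive : ∀ p → Vertex M p → ExactlyOneOf (col p ≡ 1 ⊎ ∃ (Above M p)) (∃ (Left M p))

module _ {m} (M : Matrix (suc m)) where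

  private
    n : ℕ
    n = suc m
    U : Matrix n
    U = map reverse M

  entry-reverse : ∀ i j → entry U (i , opposite j) ≡ entry M (i , j)
  entry-reverse i j = trans (cong (λ r → lookup r (opposite j)) (lookup-map i reverse M))
                            (lookup-reverse-opposite (lookup M i) j)

  vertex-reverse : ∀ {i j} → Vertex U (i , opposite j) ⇔ Vertex M (i , j)
  vertex-reverse {i} {j} = mk⇔ (trans (sym (entry-reverse i j))) (trans (entry-reverse i j))

  -- Reversal swaps left and right, keeps above, and turns the one mark of the initial state into
  -- column 1.
  exclusive-reverse : ∀ i j →
    ExactlyOneOf (Opened (initial m) U (i , opposite j)) (∃ (Right U (i , opposite j))) ⇔
    ExactlyOneOf (col (i , j) ≡ 1 ⊎ ∃ (Above M (i , j))) (∃ (Left M (i , j)))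
  exclusive-reverse i j = exactlyOneOf-cong
    (mk⇔ (Sum.map (to (lookup-initial-opposite m j)) (λ (i′ , l , v) → i′ , l , to vertex-reverse v))
         (Sum.map (from (lookup-initial-opposite m j)) (λ (i′ , l , v) → i′ , l , from vertex-reverse v)))
    (mk⇔ (λ (j′ , l , v) → opposite j′
                         , subst (opposite j′ Fin.<_) (Finₚ.opposite-involutive j) (opposite-< l)
                         , to vertex-reverse (subst (λ j → Vertex U (i , j)) (sym (Finₚ.opposite-involutive j′)) v))
         (λ (j′ , l , v) → opposite j′ , opposite-< l , from vertex-reverse v))

  private
    sum≡ : ∀ (j : Fin n) → suc (toℕ (opposite j)) ℕ.+ suc (toℕ j) ≡ suc n
    sum≡ j = cong suc (toℕ-opposite+ j)

    row+col-cancel-< : ∀ (i j : Fin n) → suc n < row (i , j) ℕ.+ col (i , j) ⇔ opposite j Fin.< i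
    row+col-cancel-< i j = mk⇔
      (λ l → ℕ.s≤s⁻¹ (ℕₚ.+-cancelʳ-< (suc (toℕ j)) _ _ (subst (_< suc (toℕ i) ℕ.+ suc (toℕ j)) (sym (sum≡ j)) l)))
      (λ l → subst (_< suc (toℕ i) ℕ.+ suc (toℕ j)) (sum≡ j) (ℕₚ.+-monoˡ-< (suc (toℕ j)) (s≤s l)))

    row+col≡sn : ∀ (i j : Fin n) → row (i , j) ℕ.+ col (i , j) ≡ suc n ⇔ i ≡ opposite j
    row+col≡sn i j = mk⇔
      (λ e → Finₚ.toℕ-injective (ℕₚ.suc-injective (ℕₚ.+-cancelʳ-≡ (suc (toℕ j)) _ _ (trans e (sym (sum≡ j))))))
      (λ { refl → sum≡ j })

    row+col≡n : ∀ (i j : Fin n) → row (i , j) ℕ.+ col (i , j) ≡ n ⇔ toℕ (opposite j) ≡ suc (toℕ i)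
    row+col≡n i j = mk⇔
      (λ e → ℕₚ.+-cancelʳ-≡ (suc (toℕ j)) _ _ (trans (toℕ-opposite+ j) (sym e)))
      (λ e → trans (cong (ℕ._+ suc (toℕ j)) (sym e)) (toℕ-opposite+ j))

  staircase⇔diagonalized : Staircase (initial m) U ⇔ Diagonalized M
  staircase⇔diagonalized = mk⇔ fwd bwd
    where
    fwd : Staircase (initial m) U → Diagonalized M
    fwd S = record
      { beyond    = λ (i , j) l → trans (sym (entry-reverse i j)) (below i (opposite j) (to (row+col-cancel-< i j) l))
      ; antidiag  = λ (i , j) e → to vertex-reverse (diagonal i (opposite j) (to (row+col≡sn i j) e))
      ; second    = λ (i , j) e → trans (sym (entry-reverse i j)) (second i (opposite j) (to (row+col≡n i j) e))
      ; exclusive = λ (i , j) v → to (exclusive-reverse i j) (exclusive i (opposite j) (from vertex-reverse v)) }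
      where
      open Staircase S
    bwd : Diagonalized M → Staircase (initial m) U
    bwd D = record
      { below     = λ i → opposite-surjective λ j l →
                      trans (entry-reverse i j) (beyond (i , j) (from (row+col-cancel-< i j) l))
      ; diagonal  = λ i → opposite-surjective λ j e →
                      from vertex-reverse (antidiag (i , j) (from (row+col≡sn i j) e))
      ; second    = λ i → opposite-surjective λ j e →
                      trans (entry-reverse i j) (second (i , j) (from (row+col≡n i j) e))
      ; exclusive = λ i → opposite-surjective λ j v →
                      from (exclusive-reverse i j) (exclusive (i , j) (to vertex-reverse v)) }
      where
      open Diagonalized D

-- Parents, children and leaves

least : ∀ {n} {P : Fin n → Set} → Decidable P → ∃ P → ∃ λ k → P k × (∀ l → P l → k Fin.≤ l)
least {suc n} P? (k , pk) with P? zero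
... | yes p₀ = zero , p₀ , λ _ _ → z≤n
least {suc n} P? (zero  , pk) | no ¬p₀ = contradiction pk ¬p₀
least {suc n} P? (suc k , pk) | no ¬p₀ with k′ , pk′ , min ← least (P? ∘ suc) (k , pk) =
  suc k′ , pk′ , λ { zero p₀ → contradiction p₀ ¬p₀ ; (suc l) pl → s≤s (min l pl) }

module _ {n} {M : Matrix n} where

  -- The sum of row and column is the potential that bounds chains of children and makes the
  -- antidiagonal vertices childless.
  parent-precedes : ∀ {q p} → Parent M q p → row q ℕ.+ col q < row p ℕ.+ col p
  parent-precedes {i′ , j′} {i , j} (_ , _ , inj₁ (refl , (i′<i , _) , _)) =
    ℕₚ.+-monoˡ-< (suc (toℕ j)) (s≤s i′<i)
  parent-precedes {i′ , j′} {i , j} (_ , _ , inj₂ (_ , refl , (j′<j , _) , _)) =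
    ℕₚ.+-monoʳ-< (suc (toℕ i)) (s≤s j′<j)

  -- A vertex beyond the antidiagonal would have children ever further out.
  beyond-antidiagonal : IsCNM M → IsUpperDiagonal M → ∀ p → suc n < row p ℕ.+ col p → entry M p ≡ false
  -- The fuel `d` keeps `n + n` below `row p + col p + d`; each child raises the potential by at
  -- least 1, which pays for one unit, and at 0 the bound `n + n` is violated.
  beyond-antidiagonal cnm ud p l = ¬-not λ v → go (suc (n ℕ.+ n)) p v l (ℕₚ.m≤n+m (suc (n ℕ.+ n)) (row p ℕ.+ col p))
    where
    bound : ∀ (p : Pos n) → row p ℕ.+ col p ≤ n ℕ.+ n
    bound (i , j) = ℕₚ.+-mono-≤ (Finₚ.toℕ<n i) (Finₚ.toℕ<n j)
    go : ∀ d p → Vertex M p → suc n < row p ℕ.+ col p → ¬ (n ℕ.+ n < row p ℕ.+ col p ℕ.+ d)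
    go zero p v l h = ℕₚ.<⇒≱ (subst (n ℕ.+ n <_) (ℕₚ.+-identityʳ _) h) (bound p)
    go (suc d) p v l h with IsCNM.complete cnm p v
    ... | inj₁ nc = ℕₚ.<⇒≢ l (sym (to (ud p) (v , nc)))
    ... | inj₂ (c , _ , _ , children) = go d c (proj₁ par) (ℕₚ.<-trans l step)
            (ℕₚ.<-≤-trans (subst (n ℕ.+ n <_) (ℕₚ.+-suc _ d) h) (ℕₚ.+-monoˡ-≤ d step))
      where
      par : Parent M p c
      par = from (children c) (inj₁ refl)
      step : row p ℕ.+ col p < row c ℕ.+ col c
      step = parent-precedes par

  counted⇒diagonalized : Counted M → Diagonalized M
  counted⇒diagonalized (cnm , ud , zs) = record
    { beyond    = beyond-antidiagonal cnm ud
    ; antidiag  = λ p e → proj₁ (from (ud p) e)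
    ; second    = zs
    ; exclusive = exclusive }
    where
    firstColumn : ∀ p → col p ≡ 1 → ¬ ∃ (Left M p)
    firstColumn (i , zero) _ (_ , () , _)
    exclusive : ∀ p → Vertex M p → ExactlyOneOf (col p ≡ 1 ⊎ ∃ (Above M p)) (∃ (Left M p))
    exclusive p v with origin? p
    ... | yes (_ , c≡1) = inj₁ (inj₁ c≡1 , firstColumn p c≡1)
    ... | no ¬o with IsCNM.xorParent cnm p v ¬o
    ...   | inj₁ (a , ¬l) = inj₁ (inj₂ a , ¬l)
    ...   | inj₂ (¬a , l) = inj₂ ([ (λ c≡1 → firstColumn p c≡1 l) , ¬a ]′ , l)

-- A vertex on the antidiagonal has no room for children. Any other vertex has antidiagonal vertices
-- below and to the right, and the nearest vertices in these two directions are its children.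
diagonalized⇒counted : ∀ {m} {M : Matrix (suc m)} → Diagonalized M → Counted M
diagonalized⇒counted {m} {M} D = cnm , upperDiagonal , second
  where
  open Diagonalized D
  n = suc m

  antidiag′ : ∀ j → Vertex M (opposite j , j)
  antidiag′ j = antidiag (opposite j , j) (cong suc (toℕ-opposite+ j))

  antidiag″ : ∀ i → Vertex M (i , opposite i)
  antidiag″ i = antidiag (i , opposite i)
    (trans (ℕₚ.+-comm (suc (toℕ i)) _) (cong suc (toℕ-opposite+ i)))

  within : ∀ p → Vertex M p → row p ℕ.+ col p ≤ suc n
  within p v = ℕₚ.≮⇒≥ λ l → contradiction v (not-¬ (beyond p l))

  origin : Vertex M (zero , zero)
  -- The leftmost vertex of the first row has no vertex above or to the left, so by `exclusive` it
  -- lies in column 1.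
  origin with least (λ j → vertex? M (zero , j)) (_ , antidiag″ zero)
  ... | zero  , v , _   = v
  ... | suc j , v , min with exclusive (zero , suc j) v
  ...   | inj₁ (inj₁ () , _)
  ...   | inj₁ (inj₂ (_ , () , _) , _)
  ...   | inj₂ (_ , j′ , j′<j , v′) = contradiction (min j′ v′) (ℕₚ.<⇒≱ j′<j)

  xorParent : ∀ p → Vertex M p → ¬ Origin p → ExactlyOneOf (∃ (Above M p)) (∃ (Left M p))
  xorParent p v ¬o with exclusive p v
  ... | inj₁ (inj₂ a , ¬l) = inj₁ (a , ¬l)
  ... | inj₂ (¬ca , l)     = inj₂ (¬ca ∘ inj₂ , l)
  xorParent (zero  , zero) v ¬o | inj₁ (inj₁ _ , ¬l) = contradiction (refl , refl) ¬o
  -- Column 1 being open from the start is replaced by a genuine vertex above, the origin.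
  xorParent (suc i , zero) v ¬o | inj₁ (inj₁ _ , ¬l) = inj₁ ((zero , s≤s z≤n , origin) , ¬l)

  noChildren : ∀ q → row q ℕ.+ col q ≡ suc n → NoChildren M q
  noChildren q e p par = ℕₚ.<⇒≱ (subst (_< row p ℕ.+ col p) e (parent-precedes {M = M} par)) (within p (proj₁ par))

  inside-column : ∀ {i j} → row (i , j) ℕ.+ col (i , j) < suc n → i Fin.< opposite j
  inside-column {i} {j} l = ℕ.s≤s⁻¹ (ℕₚ.+-cancelʳ-< (suc (toℕ j)) _ _
    (subst (suc (toℕ i) ℕ.+ suc (toℕ j) <_) (sym (cong suc (toℕ-opposite+ j))) l))

  inside-row : ∀ {i j} → row (i , j) ℕ.+ col (i , j) < suc n → j Fin.< opposite i
  inside-row {i} {j} l =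
    subst (Fin._< opposite i) (Finₚ.opposite-involutive j) (opposite-< (inside-column {i} {j} l))

  twoChildren : ∀ q → Vertex M q → row q ℕ.+ col q < suc n → TwoChildren M q
  twoChildren (i , j) v l
    with i₁ , (i<i₁ , v₁) , min₁ ←
           least (λ i′ → (i Finₚ.<? i′) ×-dec vertex? M (i′ , j)) (opposite j , inside-column {i} {j} l , antidiag′ j)
       | j₁ , (j<j₁ , v₂) , min₂ ←
           least (λ j′ → (j Finₚ.<? j′) ×-dec vertex? M (i , j′)) (opposite i , inside-row {i} {j} l , antidiag″ i)
    = (i₁ , j) , (i , j₁) , (λ e → ℕₚ.<⇒≢ i<i₁ (cong (toℕ ∘ proj₁) (sym e))) , λ p → mk⇔ (fwd p) (bwd p)
    where
    fwd : ∀ p → Parent M (i , j) p → p ≡ (i₁ , j) ⊎ p ≡ (i , j₁)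
    fwd (k , _) (w , _ , inj₁ (refl , (i<k , _) , max)) with ℕₚ.<-cmp (toℕ i₁) (toℕ k)
    ... | tri< i₁<k _ _ = contradiction (max i₁ (i₁<k , v₁)) (ℕₚ.<⇒≱ i<i₁)
    ... | tri≈ _ e _    = inj₁ (cong (_, j) (sym (Finₚ.toℕ-injective e)))
    ... | tri> _ _ k<i₁ = contradiction (min₁ k (i<k , w)) (ℕₚ.<⇒≱ k<i₁)
    fwd (_ , k) (w , _ , inj₂ (_ , refl , (j<k , _) , max)) with ℕₚ.<-cmp (toℕ j₁) (toℕ k)
    ... | tri< j₁<k _ _ = contradiction (max j₁ (j₁<k , v₂)) (ℕₚ.<⇒≱ j<j₁)
    ... | tri≈ _ e _    = inj₂ (cong (i ,_) (sym (Finₚ.toℕ-injective e)))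
    ... | tri> _ _ k<j₁ = contradiction (min₂ k (j<k , w)) (ℕₚ.<⇒≱ k<j₁)
    -- A vertex above would give `(i , j₁)` its parent in the column; having `(i , j)` to its left,
    -- it cannot have one above as well.
    notAbove : ¬ ∃ (Above M (i , j₁))
    notAbove a with exclusive (i , j₁) v₂
    ... | inj₁ (_ , ¬l)  = ¬l (j , j<j₁ , v)
    ... | inj₂ (¬ca , _) = ¬ca (inj₂ a)
    bwd : ∀ p → p ≡ (i₁ , j) ⊎ p ≡ (i , j₁) → Parent M (i , j) p
    bwd p (inj₁ refl) = v₁
      , (λ (e , _) → ℕₚ.<⇒≱ i<i₁ (subst (_≤ toℕ i) (sym (ℕₚ.suc-injective e)) z≤n))
      , inj₁ (refl , (i<i₁ , v) , λ l (l<i₁ , w) → ℕₚ.≮⇒≥ λ i<l → ℕₚ.<⇒≱ l<i₁ (min₁ l (i<l , w)))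
    bwd p (inj₂ refl) = v₂
      , (λ (_ , e) → ℕₚ.<⇒≱ j<j₁ (subst (_≤ toℕ j) (sym (ℕₚ.suc-injective e)) z≤n))
      , inj₂ (notAbove , refl , (j<j₁ , v) , λ l (l<j₁ , w) → ℕₚ.≮⇒≥ λ j<l → ℕₚ.<⇒≱ l<j₁ (min₂ l (j<l , w)))

  -- The equation accompanies `NoChildren` because `leafOnAntidiag` reads off the position of a leaf
  -- from it.
  complete : ∀ q → Vertex M q → (row q ℕ.+ col q ≡ suc n × NoChildren M q) ⊎ TwoChildren M q
  complete q v with ℕₚ.m≤n⇒m<n∨m≡n (within q v)
  ... | inj₁ l = inj₂ (twoChildren q v l)
  ... | inj₂ e = inj₁ (e , noChildren q e)

  cnm : IsCNM M
  cnm = record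
    { origin    = (zero , zero) , (refl , refl) , origin
    ; xorParent = xorParent
    ; rows      = λ i → opposite i , antidiag″ i
    ; columns   = λ j → opposite j , antidiag′ j
    ; complete  = λ q v → Sum.map₁ proj₂ (complete q v) }

  leafOnAntidiag : ∀ p → Leaf M p → row p ℕ.+ col p ≡ suc n
  leafOnAntidiag p (v , nc) with complete p v
  ... | inj₁ (e , _)                = e
  ... | inj₂ (c , _ , _ , children) = contradiction (from (children c) (inj₁ refl)) (nc c)

  upperDiagonal : IsUpperDiagonal M
  upperDiagonal p = mk⇔ (leafOnAntidiag p) (λ e → antidiag p e , noChildren p e)

-- The count as a signed sum

counted⇔fits : ∀ {m} (M : Matrix (suc m)) → Counted M ⇔ fits (initial m) (map reverse M) ≡ true
counted⇔fits {m} M =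
  ⇔-sym (fits-true (initial m) (map reverse M)) ⇔-∘
  (⇔-sym (staircase⇔diagonalized M) ⇔-∘ mk⇔ counted⇒diagonalized diagonalized⇒counted)

-- The sum over all matrices is weighted by booleans, so the equivalence is needed as an equality of
-- tests.
does-counted : ∀ {m} (M : Matrix (suc m)) → does (counted? M) ≡ fits (initial m) (map reverse M)
does-counted {m} M = trans (does-⇔ (counted⇔fits M) (counted? M) (b ≟ᵇ true)) (does-≟true b)
  where
  b = fits (initial m) (map reverse M)
  does-≟true : ∀ b → does (b ≟ᵇ true) ≡ b
  does-≟true true  = refl
  does-≟true false = refl

f≡completions : ∀ m → + f (suc m) ≡ completions (initial m)
f≡completions m = begin
  + f (suc m)
    ≡⟨ length-filter≡Σ∈ counted? (matrices (suc m)) ⟩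
  Σ∈ (matrices (suc m)) (λ M → [ does (counted? M) ]· 1ℤ)
    ≡⟨ Σ∈-cong (matrices (suc m)) (λ M → cong ([_]· 1ℤ) (does-counted M)) ⟩
  Σ∈ (matrices (suc m)) (λ M → [ fits (initial m) (map reverse M) ]· 1ℤ)
    -- Reversing the rows permutes the matrices and leaves the sum unchanged.
    ≡⟨ Σ∈-vectors-map reverse (bits (suc m)) (Σ∈-vectors-reverse (false ∷ true ∷ []) (suc m)) (suc m)
         (λ M → [ fits (initial m) M ]· 1ℤ) ⟩
  completions (initial m) ∎

theorem4p11 : ∀ (n : ℕ) → 2 ≤ n →
    + (f n) ≡ Σ< n (λ j → + ((n ∸ j) C j) * (-1ℤ ^ j) * + ((n ∸ 1 ∸ j) !))
theorem4p11 n@(suc m) _ = begin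
  + f n                                          ≡⟨ f≡completions m ⟩
  completions (initial m)                        ≡⟨ completions≡Σweight (initial m) ℕₚ.≤-refl ⟩
  Σ< (suc n) (weight (initial m))                ≡⟨ Σ<-last n (weight (initial m)) ⟩
  Σ< n (weight (initial m)) + weight (initial m) n
    ≡⟨ cong₂ _+_ (Σ<-cong n (λ j _ → weight-initial m j)) last≡0 ⟩
  Σ< n (λ j → + ((n ∸ j) C j) * (-1ℤ ^ j) * + ((m ∸ j) !)) + 0ℤ
    ≡⟨ ℤₚ.+-identityʳ _ ⟩
  Σ< n (λ j → + ((n ∸ j) C j) * (-1ℤ ^ j) * + ((m ∸ j) !)) ∎
  where
  last≡0 : weight (initial m) n ≡ 0ℤ
  -- The initial state has `n` columns, so the general identity sums degrees 0 to `n`; degree `n`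
  -- carries `0 C n`, which is 0 as `n` is a successor.
  last≡0 = trans (weight-initial m n)
                 (cong (λ d → + (d C n) * (-1ℤ ^ n) * + ((m ∸ n) !)) (ℕₚ.n∸n≡0 n))
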